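{- Let $G$ be a Coxeter group, viewed as a poset under the Bruhat order. For $v \le w$ in $G$, the interval $[v,w]=\{u\in G : v\le u\le w\}$ is boolean if and only if it is a modular lattice.
   Context: A Coxeter group $G$ comes with its generating set $S$ of involutions and relations $(st)^{m(s,t)}=1$. A reduced decomposition of $w\in G$ is an expression $w=s_1\cdots s_\ell$ with $s_i\in S$ and $\ell$ minimal. Bruhat order: $v\le w$ if some reduced decomposition of $v$ is a (not necessarily contiguous) subword of a reduced decomposition of $w$. A poset is boolean if it is isomorphic to the poset of all subsets of a finite set, ordered by inclusion. -}

module Defs where

open import Level using (_⊔_) renaming (suc to lsuc)
open import Algebra.Bundles using (Group)
import Algebra.Definitions.RawMonoid as RawMonoidDefs
open import Data.Fin.Subset using (Subset; _⊆_)
open import Data.List.Base using (List; []; _∷_; _++_; foldr; length; concat; replicate)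
import Data.List.Relation.Binary.Sublist.Propositional as Sublist
open import Data.Nat.Base as ℕ using (ℕ)
open import Data.Nat.Divisibility using (_∣_)
open import Data.Product.Base using (Σ-syntax; ∃-syntax; _×_; proj₁)
open import Function.Bundles using (_⇔_)
open import Relation.Binary.Bundles.Raw using (RawRelation)
open import Relation.Binary.Construct.Closure.Equivalence using (EqClosure)
open import Relation.Binary.Core using (Rel)
open import Relation.Binary.Lattice.Structures using (IsLattice)
open import Relation.Binary.Morphism.Structures using (IsOrderIsomorphism)
open import Relation.Binary.PropositionalEquality.Core using (_≡_)

module _ {c ℓ} (G : Group c ℓ) where
  open Group G

  infixr 8 _^_
  _^_ : Carrier → ℕ → Carrier
  g ^ k = RawMonoidDefs._×_ rawMonoid k g

  -- The order of g is n, where n = 0 encodes infinite order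
  -- (0 ∣ k holds only for k = 0).
  HasOrder : Carrier → ℕ → Set ℓ
  HasOrder g n = ∀ k → (g ^ k ≈ ε) ⇔ (n ∣ k)

-- The relations (st)^{m(s,t)} = 1 on words in S.  An entry m s t = 0 stands
-- for m(s,t) = ∞: the corresponding relator is the empty word, so it imposes
-- nothing.  Formal inverses of letters are not needed, because the relators
-- with m s s = 1 make every letter its own inverse.
module Presentation {a} {S : Set a} (m : S → S → ℕ) where

  relator : S → S → List S
  relator s t = concat (replicate (m s t) (s ∷ t ∷ []))

  data _⟶_ : Rel (List S) a where
    delete : ∀ x s t y → (x ++ relator s t ++ y) ⟶ (x ++ y)

  infix 4 _∼_
  _∼_ : Rel (List S) a
  _∼_ = EqClosure _⟶_

-- A Coxeter system: G is generated by a set S of involutions and is presented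
-- by the relations (st)^{m(s,t)} = 1, where m(s,t) is the order of st
-- (0 encoding ∞).  S may be infinite.
record CoxeterGroup c ℓ a : Set (lsuc (c ⊔ ℓ ⊔ a)) where
  field
    group : Group c ℓ

  open Group group public

  field
    S           : Set a
    ι           : S → Carrier
    ι-injective : ∀ {s t} → ι s ≈ ι t → s ≡ t
    m           : S → S → ℕ

  eval : List S → Carrier
  eval = foldr (λ s g → ι s ∙ g) ε

  open Presentation m public

  field
    involution : ∀ s → HasOrder group (ι s) 2
    order      : ∀ s t → HasOrder group (ι s ∙ ι t) (m s t)
    generates  : ∀ w → ∃[ x ] eval x ≈ w
    complete   : ∀ {x y} → eval x ≈ eval y → x ∼ y

module Bruhat {c ℓ a} (G : CoxeterGroup c ℓ a) where
  open CoxeterGroup G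

  Reduced : Carrier → List S → Set (ℓ ⊔ a)
  Reduced w x = eval x ≈ w × (∀ y → eval y ≈ w → length x ℕ.≤ length y)

  infix 4 _≤_
  _≤_ : Rel Carrier (ℓ ⊔ a)
  v ≤ w = ∃[ x ] ∃[ y ] Reduced v x × Reduced w y × x Sublist.⊆ y

  -- Only the raw relation is recorded here; that it is a partial order is a
  -- theorem about Coxeter groups.
  interval : Carrier → Carrier → RawRelation (c ⊔ ℓ ⊔ a) ℓ (ℓ ⊔ a)
  interval v w = record
    { Carrier = Σ[ u ∈ Carrier ] (v ≤ u × u ≤ w)
    ; _≈_     = λ p q → proj₁ p ≈ proj₁ q
    ; _∼_     = λ p q → proj₁ p ≤ proj₁ q
    }

module _ {c ℓ₁ ℓ₂} (P : RawRelation c ℓ₁ ℓ₂) where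
  open RawRelation P renaming (_∼_ to _≤_)

  IsBoolean : Set (c ⊔ ℓ₁ ⊔ ℓ₂)
  IsBoolean =
    ∃[ n ] Σ[ f ∈ (Carrier → Subset n) ] IsOrderIsomorphism _≈_ _≡_ _≤_ _⊆_ f

  record IsModularLattice : Set (c ⊔ ℓ₁ ⊔ ℓ₂) where
    infixr 6 _∨_
    infixr 7 _∧_
    field
      _∨_       : Carrier → Carrier → Carrier
      _∧_       : Carrier → Carrier → Carrier
      isLattice : IsLattice _≈_ _≤_ _∨_ _∧_
      modular   : ∀ x y z → x ≤ z → (x ∨ (y ∧ z)) ≈ ((x ∨ y) ∧ z)

{-# OPTIONS --safe #-}
module Submission where

open import Defs
open import Level using (_⊔_)
open import Algebra.Bundles using (Group)
open import Data.Bool.Base using (Bool; true; false; not; _xor_)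
open import Data.Bool.Properties using (not-distribˡ-xor; xor-same) renaming (_≟_ to _≟ᵇ_)
open import Data.Empty using (⊥; ⊥-elim)
open import Data.Fin.Subset using (Subset; _∪_; _∩_) renaming (_⊆_ to infix 4 _⊆ₛ_)
open import Data.Fin.Subset.Properties
  using (out⊆; in⊆in; drop-∷-⊆; p⊆p∪q; q⊆p∪q; p∩q⊆p; p∩q⊆q; x∈p∪q⁻; x∈p∩q⁺; ∪-distribˡ-∩)
  renaming (⊆-antisym to ⊆ₛ-antisym; ⊆-refl to ⊆ₛ-refl; ⊆-reflexive to ⊆ₛ-reflexive; ⊆-trans to ⊆ₛ-trans)
open import Data.List.Base using (List; []; _∷_; _++_; _∷ʳ_; map; length; concat; replicate)
open import Data.List.Properties using (length-map; ++-assoc; length-++; ∷-injective)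
import Data.List.Relation.Binary.Equality.Setoid as ListEquality
open import Data.List.Relation.Binary.Pointwise using (Pointwise-≡⇒≡; []; _∷_)
open import Data.List.Relation.Binary.Sublist.Heterogeneous.Properties using (toPointwise)
open import Data.List.Relation.Binary.Sublist.Propositional using (minimum; _⊆_; []; _∷_; ⊆-refl; ⊆-trans)
  renaming (_∷ʳ_ to infixr 5 _∷⁻_)
open import Data.List.Relation.Binary.Sublist.Propositional.Properties using (All-resp-⊆; length-mono-≤)
  renaming (++⁺ to ⊆-++)
open import Data.List.Relation.Unary.All using (All; []; _∷_)
open import Data.List.Relation.Unary.AllPairs using (AllPairs; []; _∷_)
open import Data.List.Relation.Unary.Any using (Any; here; there)
open import Data.Nat.Base as ℕ using (ℕ; zero; suc; z≤n; s≤s)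
import Data.Nat.Properties as ℕ
open import Data.Nat.Divisibility using (∣-refl; _∣?_; ∣⇒≤)
open import Data.Product.Base using (∃-syntax; _×_; _,_; proj₁; proj₂)
open import Data.Sum.Base using (_⊎_; inj₁; inj₂; [_,_]′; swap) renaming (map to map-⊎)
open import Data.Vec.Base using ([]; _∷_; here)
open import Function.Base using (_∘_; id)
open import Function.Bundles using (_⇔_; mk⇔; Equivalence)
open import Relation.Binary.Bundles.Raw using (RawRelation)
open import Relation.Binary.Core using (Rel)
import Relation.Binary.Construct.Closure.Equivalence as EqC
open import Relation.Binary.Lattice.Structures using (IsLattice)
open import Relation.Binary.Morphism.Structures using (IsOrderIsomorphism)
open import Relation.Binary.PropositionalEquality as ≡ using (_≡_; module ≡-Reasoning)
open import Relation.Binary.Structures using (IsEquivalence)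
open import Relation.Nullary.Decidable using (Dec; yes; no; does; decidable-stable; dec-true; dec-false)
open import Relation.Nullary.Negation.Core using (¬_)

-- A Bruhat interval is graded by length, and in each of its intervals of length
-- two there are exactly two elements strictly between the ends; both facts
-- follow by induction from the lifting property.  A modular lattice with these
-- properties is boolean: for an atom a, the map x ↦ ([a ≤ x], x ∨ a) splits off
-- a two-element chain and leaves the interval above a, because two distinct x, y
-- not above a with x ∨ a = y ∨ a would give three elements x, y, (x ∧ y) ∨ a
-- strictly between x ∧ y and x ∨ a.
--
-- Nothing here is decidable a priori.  The exchange condition is first obtained
-- up to double negation, from the invariance modulo 2 of the list of reflections
-- of a word; together with an analysis of dihedral prefixes, this makes an
-- algorithm computing reduced words correct, so equality in the group and the
-- Bruhat order are decidable.

-- Sublists and splittings of concatenations.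

module _ {a} {A : Set a} where

  ⊆-++⁻ : ∀ {x : List A} d {z} → x ⊆ d ++ z → ∃[ d′ ] ∃[ z′ ] x ≡ d′ ++ z′ × d′ ⊆ d × z′ ⊆ z
  ⊆-++⁻ []      τ        = [] , _ , ≡.refl , [] , τ
  ⊆-++⁻ (s ∷ d) (_ ∷⁻ τ) with ⊆-++⁻ d τ
  ... | d′ , z′ , e , σ , υ = d′ , z′ , e , s ∷⁻ σ , υ
  ⊆-++⁻ (s ∷ d) (e₀ ∷ τ) with ⊆-++⁻ d τ
  ... | d′ , z′ , e , σ , υ = _ ∷ d′ , z′ , ≡.cong (_ ∷_) e , e₀ ∷ σ , υ

  ++-split : ∀ d {z} x {b : A} {v} → d ++ z ≡ x ++ b ∷ v →
    (∃[ d′ ] d ≡ x ++ b ∷ d′ × v ≡ d′ ++ z) ⊎ (∃[ z′ ] x ≡ d ++ z′ × z ≡ z′ ++ b ∷ v)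
  ++-split []      x       e = inj₂ (x , ≡.refl , e)
  ++-split (c ∷ d) []      e with ∷-injective e
  ... | ≡.refl , f = inj₁ (d , ≡.refl , ≡.sym f)
  ++-split (c ∷ d) (_ ∷ x) e with ∷-injective e
  ... | ≡.refl , f with ++-split d x f
  ...   | inj₁ (d′ , g , h) = inj₁ (d′ , ≡.cong (c ∷_) g , h)
  ...   | inj₂ (z′ , g , h) = inj₂ (z′ , ≡.cong (c ∷_) g , h)

-- Conjugation, and lists of group elements modulo 2.

module Conjugation {c ℓ} (G : Group c ℓ) where
  open Group G
  open import Algebra.Properties.Group G
  open import Relation.Binary.Reasoning.Setoid setoid

  conj : Carrier → Carrier → Carrier
  conj g r = g ∙ r ∙ g ⁻¹

  conj-cong : ∀ {g h r r′} → g ≈ h → r ≈ r′ → conj g r ≈ conj h r′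
  conj-cong p q = ∙-cong (∙-cong p q) (⁻¹-cong p)

  conj-ε : ∀ r → conj ε r ≈ r
  conj-ε r = begin
    ε ∙ r ∙ ε ⁻¹  ≈⟨ ∙-cong (identityˡ r) ε⁻¹≈ε ⟩
    r ∙ ε         ≈⟨ identityʳ r ⟩
    r             ∎

  conj-∙ : ∀ g h r → conj (g ∙ h) r ≈ conj g (conj h r)
  conj-∙ g h r = begin
    g ∙ h ∙ r ∙ (g ∙ h) ⁻¹          ≈⟨ ∙-congˡ (⁻¹-anti-homo-∙ g h) ⟩
    g ∙ h ∙ r ∙ (h ⁻¹ ∙ g ⁻¹)       ≈⟨ assoc _ _ _ ⟨
    g ∙ h ∙ r ∙ h ⁻¹ ∙ g ⁻¹         ≈⟨ ∙-congʳ (∙-congʳ (assoc _ _ _)) ⟩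
    g ∙ (h ∙ r) ∙ h ⁻¹ ∙ g ⁻¹       ≈⟨ ∙-congʳ (assoc _ _ _) ⟩
    g ∙ (h ∙ r ∙ h ⁻¹) ∙ g ⁻¹       ∎

  conj-inverse : ∀ g r → conj g (conj (g ⁻¹) r) ≈ r
  conj-inverse g r = trans (sym (conj-∙ _ _ _)) (trans (conj-cong (inverseʳ g) refl) (conj-ε r))

  conj-inverse′ : ∀ g r → conj (g ⁻¹) (conj g r) ≈ r
  conj-inverse′ g r = trans (sym (conj-∙ _ _ _)) (trans (conj-cong (inverseˡ g) refl) (conj-ε r))

  conj-injective : ∀ g {r r′} → conj g r ≈ conj g r′ → r ≈ r′
  conj-injective g {r} {r′} p = trans (sym (conj-inverse′ g r)) (trans (conj-cong refl p) (conj-inverse′ g r′))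

  conj⇒comm : ∀ {g r r′} → r′ ≈ conj g r → r′ ∙ g ≈ g ∙ r
  conj⇒comm {g} {r} {r′} p = begin
    r′ ∙ g                ≈⟨ ∙-congʳ p ⟩
    g ∙ r ∙ g ⁻¹ ∙ g      ≈⟨ assoc _ _ _ ⟩
    g ∙ r ∙ (g ⁻¹ ∙ g)    ≈⟨ ∙-congˡ (inverseˡ g) ⟩
    g ∙ r ∙ ε             ≈⟨ identityʳ _ ⟩
    g ∙ r                 ∎

-- Multisets modulo 2 over a group whose equality need not be decidable: the
-- parity of a multiplicity is a relation, total only up to double negation.
module Mod2 {c ℓ} (G : Group c ℓ) where
  open Group G
  open Conjugation G
  open ListEquality setoid using (_≋_; ≋-refl)

  data Parity : List Carrier → Carrier → Bool → Set (c ⊔ ℓ) where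
    []   : ∀ {r} → Parity [] r false
    hit  : ∀ {g L r b} → g ≈ r → Parity L r b → Parity (g ∷ L) r (not b)
    miss : ∀ {g L r b} → ¬ g ≈ r → Parity L r b → Parity (g ∷ L) r b

  parity-total : ∀ L r → ¬ ¬ (∃[ b ] Parity L r b)
  parity-total []      r k = k (false , [])
  parity-total (g ∷ L) r k = parity-total L r λ (b , p) →
    k (b , miss (λ g≈r → k (not b , hit g≈r p)) p)

  parity-unique : ∀ {L L′ r b b′} → L ≋ L′ → Parity L r b → Parity L′ r b′ → b ≡ b′
  parity-unique []       []         []         = ≡.refl
  parity-unique (_ ∷ es) (hit _ p)  (hit _ q)  = ≡.cong not (parity-unique es p q)
  parity-unique (e ∷ _)  (hit h _)  (miss n _) = ⊥-elim (n (trans (sym e) h))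
  parity-unique (e ∷ _)  (miss n _) (hit h _)  = ⊥-elim (n (trans e h))
  parity-unique (_ ∷ es) (miss _ p) (miss _ q) = parity-unique es p q

  parity-++ : ∀ {L L′ r b b′} → Parity L r b → Parity L′ r b′ → Parity (L ++ L′) r (b xor b′)
  parity-++ []                       q = q
  parity-++ {b′ = b′} (hit {b = b} h p) q =
    ≡.subst (Parity _ _) (not-distribˡ-xor b b′) (hit h (parity-++ p q))
  parity-++ (miss n p)               q = miss n (parity-++ p q)

  parity-conj : ∀ g {L r b} → Parity (map (conj g) L) r b → Parity L (conj (g ⁻¹) r) b
  parity-conj g {[]}    []         = []
  parity-conj g {_ ∷ _} (hit h p)  =
    hit (trans (sym (conj-inverse′ g _)) (conj-cong refl h)) (parity-conj g p)
  parity-conj g {_ ∷ _} (miss n p) =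
    miss (λ h → n (trans (conj-cong refl h) (conj-inverse g _))) (parity-conj g p)

  infix 4 _≡₂_
  _≡₂_ : Rel (List Carrier) (c ⊔ ℓ)
  L ≡₂ L′ = ∀ {r b b′} → Parity L r b → Parity L′ r b′ → b ≡ b′

  ≋⇒≡₂ : ∀ {L L′} → L ≋ L′ → L ≡₂ L′
  ≋⇒≡₂ e p q = parity-unique e p q

  ≡₂-isEquivalence : IsEquivalence _≡₂_
  ≡₂-isEquivalence = record
    { refl  = λ {L} → ≋⇒≡₂ {L} ≋-refl
    ; sym   = λ e {_ _ _} p q → ≡.sym (e q p)
    -- The parity of the middle list exists only under a double negation, which can be removed
    -- because equality of booleans is decidable.
    ; trans = λ {_ M _} e f {r _ _} p q → decidable-stable (_ ≟ᵇ _) λ k →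
        parity-total M r λ (_ , o) → k (≡.trans (e p o) (f o q))
    }

  ≡₂-++ : ∀ {L L′ M M′} → L ≡₂ L′ → M ≡₂ M′ → L ++ M ≡₂ L′ ++ M′
  ≡₂-++ {L} {L′} {M} {M′} e f {r} p q = decidable-stable (_ ≟ᵇ _) λ k →
    parity-total L r λ (_ , l) → parity-total L′ r λ (_ , l′) →
    parity-total M r λ (_ , m) → parity-total M′ r λ (_ , m′) →
    k (≡.trans (parity-unique ≋-refl p (parity-++ l m))
      (≡.trans (≡.cong₂ _xor_ (e l l′) (f m m′))
               (parity-unique ≋-refl (parity-++ l′ m′) q)))

  ≡₂-double : ∀ M → M ++ M ≡₂ []
  ≡₂-double M {r} p [] = decidable-stable (_ ≟ᵇ _) λ k →
    parity-total M r λ (b , m) → k (≡.trans (parity-unique ≋-refl p (parity-++ m m)) (xor-same b))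

  ≡₂-conj : ∀ g {L L′} → L ≡₂ L′ → map (conj g) L ≡₂ map (conj g) L′
  ≡₂-conj g e p q = e (parity-conj g p) (parity-conj g q)

  -- Counting in lists without repetition.

  infix 4 _∈_
  _∈_ : Carrier → List Carrier → Set (c ⊔ ℓ)
  r ∈ L = Any (_≈ r) L

  Distinct : List Carrier → Set (c ⊔ ℓ)
  Distinct = AllPairs (λ g h → ¬ g ≈ h)

  odd⇒∈ : ∀ {L r b} → Parity L r b → b ≡ true → r ∈ L
  odd⇒∈ (hit h p)  _ = here h
  odd⇒∈ (miss n p) e = there (odd⇒∈ p e)

  absent⇒even : ∀ {L g r b} → All (λ h → ¬ g ≈ h) L → g ≈ r → Parity L r b → b ≡ false
  absent⇒even []       e []         = ≡.refl
  absent⇒even (n ∷ ns) e (hit h p)  = ⊥-elim (n (trans e (sym h)))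
  absent⇒even (n ∷ ns) e (miss _ p) = absent⇒even ns e p

  all≉⇒≉ : ∀ {L g r} → All (λ h → ¬ g ≈ h) L → r ∈ L → ¬ g ≈ r
  all≉⇒≉ (n ∷ _)  (here e)  f = n (trans f (sym e))
  all≉⇒≉ (_ ∷ ns) (there i) f = all≉⇒≉ ns i f

  distinct⇒odd : ∀ {L r b} → Distinct L → r ∈ L → Parity L r b → b ≡ true
  distinct⇒odd (ns ∷ _) (here e)  (hit _ p)  = ≡.cong not (absent⇒even ns e p)
  distinct⇒odd (_ ∷ _)  (here e)  (miss n p) = ⊥-elim (n e)
  distinct⇒odd (_ ∷ d)  (there i) (miss _ p) = distinct⇒odd d i p
  distinct⇒odd (ns ∷ _) (there i) (hit h p)  = ⊥-elim (all≉⇒≉ ns i h)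

  remove : ∀ {r L} → r ∈ L → List Carrier
  remove {L = _ ∷ L} (here _)  = L
  remove {L = g ∷ _} (there i) = g ∷ remove i

  length-remove : ∀ {r L} (i : r ∈ L) → length L ≡ suc (length (remove i))
  length-remove (here _)  = ≡.refl
  length-remove (there i) = ≡.cong suc (length-remove i)

  ∈-remove : ∀ {r g L} (i : r ∈ L) → ¬ r ≈ g → g ∈ L → g ∈ remove i
  ∈-remove (here e)  n (here e′) = ⊥-elim (n (trans (sym e) e′))
  ∈-remove (here e)  n (there j) = j
  ∈-remove (there i) n (here e)  = here e
  ∈-remove (there i) n (there j) = there (∈-remove i n j)

  -- Each element of `L` uses up one entry of `L′`, which is removed before the next one is located.
  -- Membership up to double negation suffices, since the order of natural numbers is decidable.
  pigeonhole : ∀ {L L′} → Distinct L → (∀ {r} → r ∈ L → ¬ ¬ (r ∈ L′)) → length L ℕ.≤ length L′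
  pigeonhole {[]}     _        _ = z≤n
  pigeonhole {g ∷ L} {L′} (ns ∷ d) f = decidable-stable (_ ℕ.≤? _) λ k →
    f (here refl) λ i → k (≡.subst (_ ℕ.≤_) (≡.sym (length-remove i))
      (s≤s (pigeonhole d λ j l → f (there j) λ i′ →
        l (∈-remove i (all≉⇒≉ ns j) i′))))

  -- A member of a list without repetition has odd multiplicity there, hence also in `L′`, and so it
  -- occurs in `L′`.
  ≡₂-length : ∀ {L L′} → Distinct L → L ≡₂ L′ → length L ℕ.≤ length L′
  ≡₂-length {L} {L′} d e = pigeonhole d λ {r} i k →
    parity-total L r λ (_ , p) → parity-total L′ r λ (_ , q) →
    k (odd⇒∈ q (≡.trans (≡.sym (e p q)) (distinct⇒odd d i p)))

-- Words in the generators and their reflections.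

module CoxeterWords {c ℓ a} (G : CoxeterGroup c ℓ a) where
  open CoxeterGroup G
  open Bruhat G using (Reduced)
  open import Algebra.Properties.Group group
  open import Algebra.Properties.Monoid.Mult monoid using (×-homo-+)
  open import Relation.Binary.Reasoning.Setoid setoid
  open Conjugation group
  open Mod2 group
  open ListEquality setoid using (_≋_; ≋-refl; ≋-sym; ≋-trans) renaming (++⁺ to ≋-++)

  infixr 8 _^^_
  _^^_ : Carrier → ℕ → Carrier
  _^^_ = _^_ group

  infix 4 _≐_
  _≐_ : Rel (List S) ℓ
  x ≐ y = eval x ≈ eval y

  ^^-comm : ∀ g k → g ^^ k ∙ g ≈ g ∙ g ^^ k
  ^^-comm g zero    = trans (identityˡ _) (sym (identityʳ _))
  ^^-comm g (suc k) = trans (assoc _ _ _) (∙-congˡ (^^-comm g k))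

  ι² : ∀ s → ι s ∙ ι s ≈ ε
  ι² s = trans (∙-congˡ (sym (identityʳ _))) (Equivalence.from (involution s 2) ∣-refl)

  ι⁻¹ : ∀ s → ι s ⁻¹ ≈ ι s
  ι⁻¹ s = sym (inverseˡ-unique _ _ (ι² s))

  ι-cancel : ∀ s g → ι s ∙ (ι s ∙ g) ≈ g
  ι-cancel s g = trans (sym (assoc _ _ _)) (trans (∙-congʳ (ι² s)) (identityˡ g))

  ι-cancelˡ : ∀ s {g h} → ι s ∙ g ≈ ι s ∙ h → g ≈ h
  ι-cancelˡ s e = trans (sym (ι-cancel s _)) (trans (∙-congˡ e) (ι-cancel s _))

  eval-++ : ∀ x y → eval (x ++ y) ≈ eval x ∙ eval y
  eval-++ []      y = sym (identityˡ _)
  eval-++ (s ∷ x) y = trans (∙-congˡ (eval-++ x y)) (sym (assoc _ _ _))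

  ++-congˡ : ∀ x {y y′} → y ≐ y′ → x ++ y ≐ x ++ y′
  ++-congˡ []      e = e
  ++-congˡ (s ∷ x) e = ∙-congˡ (++-congˡ x e)

  ++-congʳ : ∀ {x x′} y → x ≐ x′ → x ++ y ≐ x′ ++ y
  ++-congʳ {x} {x′} y e = trans (eval-++ x y) (trans (∙-congʳ e) (sym (eval-++ x′ y)))

  -- A letter `t` preceded by the prefix `q` contributes the conjugate of `ι t` by `eval q`.
  reflections : List S → List Carrier
  reflections []      = []
  reflections (s ∷ x) = ι s ∷ map (conj (ι s)) (reflections x)

  length-reflections : ∀ x → length (reflections x) ≡ length x
  length-reflections []      = ≡.refl
  length-reflections (s ∷ x) = ≡.cong suc (≡.trans (length-map (conj (ι s)) (reflections x)) (length-reflections x))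

  map-conj-cong : ∀ {g h L L′} → g ≈ h → L ≋ L′ → map (conj g) L ≋ map (conj h) L′
  map-conj-cong p []       = []
  map-conj-cong p (e ∷ es) = conj-cong p e ∷ map-conj-cong p es

  map-conj-∙ : ∀ g h L → map (conj (g ∙ h)) L ≋ map (conj g) (map (conj h) L)
  map-conj-∙ g h []      = []
  map-conj-∙ g h (r ∷ L) = conj-∙ g h r ∷ map-conj-∙ g h L

  map-conj-ε : ∀ L → map (conj ε) L ≋ L
  map-conj-ε []      = []
  map-conj-ε (r ∷ L) = conj-ε r ∷ map-conj-ε L

  map-conj-++ : ∀ g L L′ → map (conj g) (L ++ L′) ≋ map (conj g) L ++ map (conj g) L′
  map-conj-++ g []      L′ = ≋-refl
  map-conj-++ g (r ∷ L) L′ = refl ∷ map-conj-++ g L L′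

  reflections-++ : ∀ x y → reflections (x ++ y) ≋ reflections x ++ map (conj (eval x)) (reflections y)
  reflections-++ []      y = ≋-sym (map-conj-ε _)
  reflections-++ (s ∷ x) y = refl ∷
    ≋-trans (map-conj-cong refl (reflections-++ x y))
    (≋-trans (map-conj-++ (ι s) (reflections x) _)
      (≋-++ ≋-refl (≋-sym (map-conj-∙ (ι s) (eval x) (reflections y)))))

  -- The i-th reflection of the word (st)^k is (st)^i s, so these are periodic
  -- with period m s t, and each occurs twice in the relator.
  module _ (s t : S) where
    private
      ρ = ι s ∙ ι t

    rotations : ℕ → ℕ → List Carrier
    rotations k zero    = []
    rotations k (suc n) = ρ ^^ k ∙ ι s ∷ rotations (suc k) n

    rotations-++ : ∀ k n n′ → rotations k (n ℕ.+ n′) ≋ rotations k n ++ rotations (n ℕ.+ k) n′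
    rotations-++ k zero    n′ = ≋-refl
    rotations-++ k (suc n) n′ rewrite ≡.sym (ℕ.+-suc n k) = refl ∷ rotations-++ (suc k) n n′

    rotations-period : ∀ {p} → ρ ^^ p ≈ ε → ∀ k n → rotations (p ℕ.+ k) n ≋ rotations k n
    rotations-period e k zero = []
    rotations-period {p} e k (suc n) =
      ∙-congʳ (trans (×-homo-+ ρ p k) (trans (∙-congʳ e) (identityˡ _)))
      ∷ ≡.subst (λ i → rotations i n ≋ rotations (suc k) n) (ℕ.+-suc p k) (rotations-period {p} e (suc k) n)

    private
      ιs∙ρ⁻¹ : ι s ∙ ρ ⁻¹ ≈ ρ ∙ ι s
      ιs∙ρ⁻¹ = begin
        ι s ∙ ρ ⁻¹             ≈⟨ ∙-congˡ (⁻¹-anti-homo-∙ _ _) ⟩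
        ι s ∙ (ι t ⁻¹ ∙ ι s ⁻¹) ≈⟨ ∙-congˡ (∙-cong (ι⁻¹ t) (ι⁻¹ s)) ⟩
        ι s ∙ (ι t ∙ ι s)      ≈⟨ assoc _ _ _ ⟨
        ρ ∙ ι s                ∎

    conj-rotation : ∀ k → conj ρ (ρ ^^ k ∙ ι s) ≈ ρ ^^ suc (suc k) ∙ ι s
    conj-rotation k = begin
      ρ ∙ (ρ ^^ k ∙ ι s) ∙ ρ ⁻¹   ≈⟨ ∙-congʳ (assoc _ _ _) ⟨
      ρ ∙ ρ ^^ k ∙ ι s ∙ ρ ⁻¹     ≈⟨ assoc _ _ _ ⟩
      ρ ∙ ρ ^^ k ∙ (ι s ∙ ρ ⁻¹)   ≈⟨ ∙-congˡ ιs∙ρ⁻¹ ⟩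
      ρ ∙ ρ ^^ k ∙ (ρ ∙ ι s)      ≈⟨ assoc _ _ _ ⟨
      ρ ∙ ρ ^^ k ∙ ρ ∙ ι s        ≈⟨ ∙-congʳ (^^-comm ρ (suc k)) ⟩
      ρ ^^ suc (suc k) ∙ ι s      ∎

    conj-rotations : ∀ k n → map (conj ρ) (rotations k n) ≋ rotations (suc (suc k)) n
    conj-rotations k zero    = []
    conj-rotations k (suc n) = conj-rotation k ∷ conj-rotations (suc k) n

    alternating : ℕ → List S
    alternating k = concat (replicate k (s ∷ t ∷ []))

    eval-alternating : ∀ k → eval (alternating k) ≈ ρ ^^ k
    eval-alternating zero    = refl
    eval-alternating (suc k) = trans (sym (assoc _ _ _)) (∙-congˡ (eval-alternating k))

    reflections-alternating : ∀ k → reflections (alternating k) ≋ rotations 0 (k ℕ.+ k)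
    reflections-alternating zero    = []
    reflections-alternating (suc k) rewrite ℕ.+-suc k k =
      sym (identityˡ _) ∷ second ∷
      ≋-trans (≋-sym (map-conj-∙ (ι s) (ι t) _))
      (≋-trans (map-conj-cong refl (reflections-alternating k)) (conj-rotations 0 (k ℕ.+ k)))
      where
      second : conj (ι s) (ι t) ≈ ρ ^^ 1 ∙ ι s
      second = ∙-cong (sym (identityʳ _)) (ι⁻¹ s)

    ρ^m : ρ ^^ m s t ≈ ε
    ρ^m = Equivalence.from (order s t (m s t)) ∣-refl

    eval-relator : eval (relator s t) ≈ ε
    eval-relator = trans (eval-alternating (m s t)) ρ^m

    reflections-relator : ∃[ M ] reflections (relator s t) ≋ M ++ M
    reflections-relator = rotations 0 (m s t) ,
      ≋-trans (reflections-alternating (m s t))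
      (≋-trans (rotations-++ 0 (m s t) (m s t))
        (≋-++ ≋-refl (rotations-period {m s t} ρ^m 0 (m s t))))

  private
    module ≡₂ = IsEquivalence ≡₂-isEquivalence

  -- The relator contributes a list `M ++ M`, which vanishes modulo 2. As it evaluates to `ε`, its
  -- deletion leaves the reflections of the later letters unchanged.
  reflections-delete : ∀ {x y} → x ⟶ y → reflections x ≡₂ reflections y
  reflections-delete (delete (r ∷ x) s t y) = ≡₂-++ {ι r ∷ []} {ι r ∷ []} (≡₂.refl {ι r ∷ []})
    (≡₂-conj (ι r) {reflections (x ++ relator s t ++ y)} {reflections (x ++ y)} (reflections-delete (delete x s t y)))
  reflections-delete (delete [] s t y) with reflections-relator s t
  ... | M , e = ≡₂.trans {reflections (relator s t ++ y)} {(M ++ M) ++ reflections y} {reflections y}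
    (≋⇒≡₂ (≋-trans (reflections-++ (relator s t) y)
      (≋-++ e (≋-trans (map-conj-cong (eval-relator s t) ≋-refl) (map-conj-ε _)))))
    (≡₂-++ {M ++ M} {[]} {reflections y} {reflections y} (≡₂-double M) (≡₂.refl {reflections y}))

  reflections-∼ : ∀ {x y} → x ∼ y → reflections x ≡₂ reflections y
  reflections-∼ = EqC.gfold ≡₂-isEquivalence reflections (λ {x} {y} → reflections-delete {x} {y})

  -- Reduced words and the deletion condition.

  IsReduced : List S → Set (ℓ ⊔ a)
  IsReduced x = ∀ y → y ≐ x → length x ℕ.≤ length y

  -- By `complete`, every word for the same element has the same reflections modulo 2, so its list
  -- of reflections has at least as many entries.
  distinct⇒reduced : ∀ {x} → Distinct (reflections x) → IsReduced x
  distinct⇒reduced {x} d y e = ≡.subst₂ ℕ._≤_ (length-reflections x) (length-reflections y)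
    (≡₂-length {reflections x} {reflections y} d (reflections-∼ {x} {y} (complete (sym e))))

  -- Two letters that can be deleted together; the equation says that the
  -- reflections attached to them coincide.
  record Redundant (x : List S) : Set (ℓ ⊔ a) where
    constructor redundant
    field
      p   : List S
      s   : S
      q   : List S
      t   : S
      u   : List S
      x≡  : x ≡ p ++ s ∷ q ++ t ∷ u
      sq≐qt : s ∷ q ≐ q ∷ʳ t

  redundant-∷ : ∀ {s x} → Redundant x → Redundant (s ∷ x)
  redundant-∷ (redundant p s q t u e f) = redundant (_ ∷ p) s q t u (≡.cong (_ ∷_) e) f

  eval-∷ʳ : ∀ q t → eval (q ∷ʳ t) ≈ eval q ∙ ι t
  eval-∷ʳ q t = trans (eval-++ q (t ∷ [])) (∙-congˡ (identityʳ _))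

  -- The relation turns `s q t` into `q t t`, and the two letters `t` cancel.
  redundant-delete : ∀ p s q t u → s ∷ q ≐ q ∷ʳ t → p ++ q ++ u ≐ p ++ s ∷ q ++ t ∷ u
  redundant-delete p s q t u e = ++-congˡ p (begin
    eval (q ++ u)               ≈⟨ ++-congˡ q (ι-cancel t (eval u)) ⟨
    eval (q ++ t ∷ t ∷ u)       ≡⟨ ≡.cong eval (++-assoc q (t ∷ []) (t ∷ u)) ⟨
    eval ((q ∷ʳ t) ++ t ∷ u)    ≈⟨ ++-congʳ {s ∷ q} {q ∷ʳ t} (t ∷ u) e ⟨
    eval (s ∷ q ++ t ∷ u)       ∎)

  delete-< : ∀ (p : List S) s q t u → length (p ++ q ++ u) ℕ.< length (p ++ s ∷ q ++ t ∷ u)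
  delete-< []      s q t u = s≤s (length-mono-≤ (⊆-++ (⊆-refl {x = q}) (t ∷⁻ ⊆-refl)))
  delete-< (_ ∷ p) s q t u = s≤s (delete-< p s q t u)

  ∈-map-conj : ∀ {g r} L → r ∈ map (conj g) L → ∃[ h ] h ∈ L × r ≈ conj g h
  ∈-map-conj (g ∷ L) (here e)  = g , here refl , sym e
  ∈-map-conj (g ∷ L) (there i) with ∈-map-conj L i
  ... | h , j , e = h , there j , e

  ∈-reflections : ∀ {r} x → r ∈ reflections x →
    ∃[ q ] ∃[ t ] ∃[ u ] x ≡ q ++ t ∷ u × r ≈ conj (eval q) (ι t)
  ∈-reflections (s ∷ x) (here e)  = [] , s , x , ≡.refl , trans (sym e) (sym (conj-ε _))
  ∈-reflections (s ∷ x) (there i) with ∈-map-conj (reflections x) i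
  ... | g , j , e with ∈-reflections x j
  ... | q , t , u , eq , f = s ∷ q , t , u , ≡.cong (s ∷_) eq ,
    trans e (trans (conj-cong refl f) (sym (conj-∙ _ _ _)))

  -- Suppose that the first reflection `ι s` recurs as `conj (ι s) h`. Conjugation by `ι s` fixes
  -- `ι s`, so `ι s ≈ h`. As `h` is the conjugate of a later letter `t` by the word `q` between the
  -- two, this says that `s ∷ q` and `q ∷ʳ t` agree.
  irredundant⇒distinct : ∀ x → ¬ Redundant x → Distinct (reflections x)
  irredundant⇒distinct []      n = []
  irredundant⇒distinct (s ∷ x) n = fresh id ∷ map-distinct (irredundant⇒distinct x (n ∘ redundant-∷))
    where
    clash : ∀ {g} → g ∈ map (conj (ι s)) (reflections x) → ¬ ι s ≈ g
    clash i e with ∈-map-conj (reflections x) i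
    ... | h , j , f with ∈-reflections x j
    ... | q , t , u , eq , k = n (redundant [] s q t u (≡.cong (s ∷_) eq)
      (trans (conj⇒comm (trans (conj-injective (ι s) (trans conj-ιs (trans e f))) k)) (sym (eval-∷ʳ q t))))
      where
      conj-ιs : conj (ι s) (ι s) ≈ ι s
      conj-ιs = trans (assoc _ _ _) (trans (∙-congˡ (inverseʳ _)) (identityʳ _))

    fresh : ∀ {L} → (∀ {r} → r ∈ L → r ∈ map (conj (ι s)) (reflections x)) → All (λ h → ¬ ι s ≈ h) L
    fresh {[]}    f = []
    fresh {g ∷ L} f = clash (f (here refl)) ∷ fresh (f ∘ there)

    map-all : ∀ {g L} → All (λ h → ¬ g ≈ h) L → All (λ h → ¬ conj (ι s) g ≈ h) (map (conj (ι s)) L)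
    map-all []       = []
    map-all (n ∷ ns) = (n ∘ conj-injective (ι s)) ∷ map-all ns

    map-distinct : ∀ {L} → Distinct L → Distinct (map (conj (ι s)) L)
    map-distinct []       = []
    map-distinct (ns ∷ d) = map-all ns ∷ map-distinct d

  -- The deletion condition in contrapositive form, which makes sense before the existence of a
  -- redundant pair can be decided.
  irredundant⇒reduced : ∀ x → ¬ Redundant x → IsReduced x
  irredundant⇒reduced x n = distinct⇒reduced (irredundant⇒distinct x n)

  reduced-resp : ∀ x y → x ≐ y → length x ≡ length y → IsReduced x → IsReduced y
  reduced-resp x y e l r z f = ≡.subst (ℕ._≤ length z) l (r z (trans f (sym e)))

  reduced-++⁻ʳ : ∀ x y → IsReduced (x ++ y) → IsReduced y
  reduced-++⁻ʳ []      y r = r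
  reduced-++⁻ʳ (s ∷ x) y r = reduced-++⁻ʳ x y λ z e → ℕ.≤-pred (r (s ∷ z) (∙-congˡ e))

  reduced-[_] : ∀ s → IsReduced (s ∷ [])
  -- If the empty word represented `s`, the order 2 of `s` would divide 1.
  reduced-[ s ] []      e with ∣⇒≤ (Equivalence.to (involution s 1) (sym e))
  ... | s≤s ()
  reduced-[ s ] (_ ∷ _) e = s≤s z≤n

  module _ {z} (red : IsReduced z) where
    private
      Ascent = λ c → IsReduced (c ∷ z)

    -- A shortest counterexample d ++ z₀ would be a reduced word, by deletion, so
    -- that the first letter of d would be a descent of z.
    coset-minimal : ∀ d z₀ → All Ascent d → d ++ z₀ ≐ z → length z ℕ.≤ length z₀
    coset-minimal d z₀ = go (length (d ++ z₀)) d z₀ ℕ.≤-refl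
      where
      go : ∀ n d z₀ → length (d ++ z₀) ℕ.≤ n → All Ascent d → d ++ z₀ ≐ z → length z ℕ.≤ length z₀
      go n []      z₀ _ _        e = red z₀ e
      go n (c ∷ d) z₀ b (r ∷ rs) e = decidable-stable (_ ℕ.≤? _) λ k →
        ℕ.<-irrefl ≡.refl (ℕ.≤-trans (ℕ.≤-trans (r (d ++ z₀) (ι-cancelˡ c (trans e (sym (ι-cancel c _)))))
          (ℕ.n≤1+n _)) (irredundant⇒reduced (c ∷ d ++ z₀) (k ∘ shorten n b) z (sym e)))
        where
        shorten : ∀ n → length (c ∷ d ++ z₀) ℕ.≤ n → Redundant (c ∷ d ++ z₀) → length z ℕ.≤ length z₀
        shorten (suc n) (s≤s b) (redundant p s q t u x≡ f)
          -- The shortened word is a subword of `c ∷ d ++ z₀`, so it splits into letters of `c ∷ d`,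
          -- which are still ascents, and a subword `z₁` of `z₀`. The bound for `z₁` implies the one
          -- for `z₀`.
          with ⊆-++⁻ (c ∷ d) {z₀} (≡.subst (p ++ q ++ u ⊆_) (≡.sym x≡)
            (⊆-++ (⊆-refl {x = p}) (s ∷⁻ ⊆-++ (⊆-refl {x = q}) (t ∷⁻ ⊆-refl))))
        ... | d′ , z₁ , g , σ , υ = ℕ.≤-trans
          (go n d′ z₁ (ℕ.≤-pred (ℕ.≤-trans shorter (s≤s b))) (All-resp-⊆ σ (r ∷ rs)) equal)
          (length-mono-≤ υ)
          where
          equal : d′ ++ z₁ ≐ z
          equal = begin
            eval (d′ ++ z₁)                   ≡⟨ ≡.cong eval g ⟨
            eval (p ++ q ++ u)                ≈⟨ redundant-delete p s q t u f ⟩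
            eval (p ++ s ∷ q ++ t ∷ u)        ≡⟨ ≡.cong eval x≡ ⟨
            eval (c ∷ d ++ z₀)                ≈⟨ e ⟩
            eval z                            ∎

          shorter : suc (length (d′ ++ z₁)) ℕ.≤ length (c ∷ d ++ z₀)
          shorter = ≡.subst₂ (λ x y → suc (length x) ℕ.≤ length y) g (≡.sym x≡) (delete-< p s q t u)

    -- Letters are involutions, so those of `d` can be moved one by one to the front of `d′`.
    coset-minimal-++ : ∀ d d′ z₀ → All Ascent d → All Ascent d′ → d′ ++ z₀ ≐ d ++ z → length z ℕ.≤ length z₀
    coset-minimal-++ []      d′ z₀ _        rs′ e = coset-minimal d′ z₀ rs′ e
    coset-minimal-++ (c ∷ d) d′ z₀ (r ∷ rs) rs′ e = coset-minimal-++ d (c ∷ d′) z₀ rs (r ∷ rs′)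
      (trans (∙-congˡ e) (ι-cancel c _))

  -- Alternating words and braid relations.

  alt : S → S → ℕ → List S
  alt s t zero    = []
  alt s t (suc n) = s ∷ alt t s n

  -- This is the last letter of `alt s t (suc n)`, equivalently the letter that extends `alt s t n`.
  end : S → S → ℕ → S
  end s t zero    = s
  end s t (suc n) = end t s n

  alt-∷ʳ : ∀ s t n → alt s t (suc n) ≡ alt s t n ∷ʳ end s t n
  alt-∷ʳ s t zero    = ≡.refl
  alt-∷ʳ s t (suc n) = ≡.cong (s ∷_) (alt-∷ʳ t s n)

  length-alt : ∀ s t n → length (alt s t n) ≡ n
  length-alt s t zero    = ≡.refl
  length-alt s t (suc n) = ≡.cong suc (length-alt t s n)

  length-alt-++ : ∀ s t n z → length (alt s t n ++ z) ≡ n ℕ.+ length z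
  length-alt-++ s t zero    z = ≡.refl
  length-alt-++ s t (suc n) z = ≡.cong suc (length-alt-++ t s n z)

  end-both : ∀ {p} (P : S → Set p) s t n → P (end s t n) → P (end s t (suc n)) → P s × P t
  end-both P s t zero    p q = p , q
  end-both P s t (suc n) p q with end-both P t s n p q
  ... | q′ , p′ = p′ , q′

  alt-all : ∀ {p} {P : S → Set p} {s t} → P s → P t → ∀ n → All P (alt s t n)
  alt-all p q zero    = []
  alt-all p q (suc n) = p ∷ alt-all q p n

  alt-++⁻ˡ : ∀ {s t} n q {u} → alt s t n ≡ q ++ u → q ≡ alt s t (length q)
  alt-++⁻ˡ n       []      e = ≡.refl
  alt-++⁻ˡ (suc n) (c ∷ q) e with ∷-injective e
  ... | ≡.refl , f = ≡.cong (c ∷_) (alt-++⁻ˡ n q f)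

  alt-++⁻ʳ : ∀ {s t} n p {u} → alt s t n ≡ p ++ u →
    u ≡ alt s t (length u) ⊎ u ≡ alt t s (length u)
  alt-++⁻ʳ {s} {t} n []  e = inj₁ (≡.subst (λ x → x ≡ alt s t (length x)) e
    (≡.cong (alt s t) (≡.sym (length-alt s t n))))
  alt-++⁻ʳ (suc n) (c ∷ p) e with alt-++⁻ʳ n p (proj₂ (∷-injective e))
  ... | inj₁ f = inj₂ f
  ... | inj₂ f = inj₁ f

  -- Shows the quotient of the two alternating words of length `n` to be a power of `ι s ∙ ι t`,
  -- whose triviality is governed by `m s t`.
  eval-alt : ∀ s t n → eval (alt s t n) ≈ (ι s ∙ ι t) ^^ n ∙ eval (alt t s n)
  eval-alt s t zero    = sym (identityˡ _)
  eval-alt s t (suc n) = begin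
    ι s ∙ eval (alt t s n)                              ≈⟨ ∙-congˡ (eval-alt t s n) ⟩
    ι s ∙ ((ι t ∙ ι s) ^^ n ∙ X)                        ≈⟨ assoc _ _ _ ⟨
    ι s ∙ (ι t ∙ ι s) ^^ n ∙ X                          ≈⟨ ∙-congʳ (shift n) ⟩
    (ι s ∙ ι t) ^^ n ∙ ι s ∙ X                          ≈⟨ assoc _ _ _ ⟩
    (ι s ∙ ι t) ^^ n ∙ (ι s ∙ X)                        ≈⟨ ∙-congˡ (∙-congˡ (ι-cancel t X)) ⟨
    (ι s ∙ ι t) ^^ n ∙ (ι s ∙ (ι t ∙ (ι t ∙ X)))        ≈⟨ ∙-congˡ (assoc _ _ _) ⟨
    (ι s ∙ ι t) ^^ n ∙ (ι s ∙ ι t ∙ (ι t ∙ X))          ≈⟨ assoc _ _ _ ⟨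
    (ι s ∙ ι t) ^^ n ∙ (ι s ∙ ι t) ∙ (ι t ∙ X)          ≈⟨ ∙-congʳ (^^-comm (ι s ∙ ι t) n) ⟩
    (ι s ∙ ι t) ^^ suc n ∙ (ι t ∙ X)                    ∎
    where
    X = eval (alt s t n)
    shift : ∀ n → ι s ∙ (ι t ∙ ι s) ^^ n ≈ (ι s ∙ ι t) ^^ n ∙ ι s
    shift zero    = trans (identityʳ _) (sym (identityˡ _))
    shift (suc n) = begin
      ι s ∙ (ι t ∙ ι s ∙ (ι t ∙ ι s) ^^ n)    ≈⟨ ∙-congˡ (assoc _ _ _) ⟩
      ι s ∙ (ι t ∙ (ι s ∙ (ι t ∙ ι s) ^^ n))  ≈⟨ assoc _ _ _ ⟨
      ι s ∙ ι t ∙ (ι s ∙ (ι t ∙ ι s) ^^ n)    ≈⟨ ∙-congˡ (shift n) ⟩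
      ι s ∙ ι t ∙ ((ι s ∙ ι t) ^^ n ∙ ι s)    ≈⟨ assoc _ _ _ ⟨
      (ι s ∙ ι t) ^^ suc n ∙ ι s              ∎

  -- The order of `ι s ∙ ι t` is given, so a divisibility test decides this equality before equality
  -- in the group is known to be decidable.
  braid? : ∀ s t n → Dec (alt s t n ≐ alt t s n)
  braid? s t n with m s t ∣? n
  ... | yes d = yes (trans (eval-alt s t n)
    (trans (∙-congʳ (Equivalence.from (order s t n) d)) (identityˡ _)))
  ... | no nd = no λ e → nd (Equivalence.to (order s t n)
    (identityˡ-unique _ _ (trans (sym (eval-alt s t n)) e)))

  -- A redundant pair inside the alternating prefix would give a braid relation of length less than
  -- `n`. If its second letter lies in `z`, deleting the pair leaves a remainder shorter than `z`,
  -- against the minimality of `z` in its coset.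
  alt-reduced : ∀ {s t z} → IsReduced z → IsReduced (s ∷ z) → IsReduced (t ∷ z) → ∀ n →
    (∀ j → suc j ℕ.< n → ¬ alt s t (suc j) ≐ alt t s (suc j)) → IsReduced (alt s t n ++ z)
  alt-reduced {s} {t} {z} red rs rt n nb = irredundant⇒reduced _ contra
    where
    contra : ¬ Redundant (alt s t n ++ z)
    contra (redundant p s₁ q t₁ u x≡ f)
      with ++-split (alt s t n) (p ++ s₁ ∷ q) (≡.trans x≡ (≡.sym (++-assoc p (s₁ ∷ q) (t₁ ∷ u))))
    ... | inj₁ (d , e , _) with ≡.trans e (++-assoc p (s₁ ∷ q) (t₁ ∷ d))
    ...   | e′ = clash (alt-++⁻ʳ n p e′)
      where
      bound : suc (length q) ℕ.< n
      bound = ≡.subst (suc (suc (length q)) ℕ.≤_) (≡.trans (≡.cong length (≡.sym e′)) (length-alt s t n)) (long p)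
        where
        long : ∀ p → suc (suc (length q)) ℕ.≤ length (p ++ s₁ ∷ q ++ t₁ ∷ d)
        long [] rewrite length-++ q {t₁ ∷ d} = s≤s (≡.subst (suc (length q) ℕ.≤_)
          (≡.sym (ℕ.+-suc _ _)) (s≤s (ℕ.m≤m+n _ _)))
        long (_ ∷ p) = ℕ.≤-trans (long p) (ℕ.n≤1+n _)

      -- Inside an alternating word, `s₁ ∷ q` and `q ∷ʳ t₁` are alternating words of equal length
      -- with opposite first letters, so `f` is a braid relation.
      braid : ∀ {a b} N → alt a b N ≡ s₁ ∷ q ++ t₁ ∷ d → alt a b (suc (length q)) ≐ alt b a (suc (length q))
      braid {a} {b} (suc N) g with ∷-injective g
      ... | ≡.refl , h = trans (∙-congˡ (reflexive (≡.cong eval (≡.sym (alt-++⁻ˡ N q h)))))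
        (trans f (reflexive (≡.cong eval (≡.trans
          (alt-++⁻ˡ N (q ∷ʳ t₁) (≡.trans h (≡.sym (++-assoc q (t₁ ∷ []) d))))
          (≡.cong (alt b a) (≡.trans (length-++ q) (ℕ.+-comm _ 1)))))))

      clash : (s₁ ∷ q ++ t₁ ∷ d ≡ alt s t (length (s₁ ∷ q ++ t₁ ∷ d)))
            ⊎ (s₁ ∷ q ++ t₁ ∷ d ≡ alt t s (length (s₁ ∷ q ++ t₁ ∷ d))) → ⊥
      clash (inj₁ g) = nb (length q) bound (braid _ (≡.sym g))
      clash (inj₂ g) = nb (length q) bound (sym (braid _ (≡.sym g)))
    contra (redundant p s₁ q t₁ u x≡ f) | inj₂ (z′ , e , g)
      with ⊆-++⁻ (alt s t n) {z′} (≡.subst (p ++ q ⊆_) e (⊆-++ (⊆-refl {x = p}) (s₁ ∷⁻ ⊆-refl {x = q})))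
    ... | d′ , z₁ , h , σ , υ = ℕ.<-irrefl ≡.refl (ℕ.≤-trans (s≤s minimal) shorter)
      where
      minimal : length z ℕ.≤ length (z₁ ++ u)
      minimal = coset-minimal-++ red (alt s t n) d′ (z₁ ++ u) (alt-all rs rt n) (All-resp-⊆ σ (alt-all rs rt n)) (begin
        eval (d′ ++ z₁ ++ u)         ≡⟨ ≡.cong eval (++-assoc d′ z₁ u) ⟨
        eval ((d′ ++ z₁) ++ u)       ≡⟨ ≡.cong (λ x → eval (x ++ u)) h ⟨
        eval ((p ++ q) ++ u)         ≡⟨ ≡.cong eval (++-assoc p q u) ⟩
        eval (p ++ q ++ u)           ≈⟨ redundant-delete p s₁ q t₁ u f ⟩
        eval (p ++ s₁ ∷ q ++ t₁ ∷ u) ≡⟨ ≡.cong eval x≡ ⟨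
        eval (alt s t n ++ z)        ∎)

      shorter : suc (length (z₁ ++ u)) ℕ.≤ length z
      shorter rewrite g | length-++ z₁ {u} | length-++ z′ {t₁ ∷ u} | ℕ.+-suc (length z′) (length u) =
        s≤s (ℕ.+-monoˡ-≤ (length u) (length-mono-≤ υ))

  -- The exchange condition as an algorithm, and decidable equality.

  Descent : S → List S → Set (ℓ ⊔ a)
  Descent s y = ∃[ y′ ] s ∷ y′ ≐ y × suc (length y′) ≡ length y

  -- By the braid relation, `y` has expressions of its own length beginning with `r` and with `s`.
  -- The value `n = 0` covers the case where the two letters coincide.
  record Dihedral (r s : S) (y : List S) : Set (ℓ ⊔ a) where
    constructor dihedral
    field
      n     : ℕ
      z     : List S
      y≐    : alt r s (suc n) ++ z ≐ y
      braid : alt s r (suc n) ≐ alt r s (suc n)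
      size  : suc n ℕ.+ length z ≡ length y

  private
    Strip : ℕ → Set (ℓ ⊔ a)
    Strip n = ∀ s y → length y ℕ.≤ n → IsReduced y → Descent s y ⊎ IsReduced (s ∷ y)

  -- Letters r, s are stripped from y in turn until a braid relation is reached or
  -- a remainder z having neither r nor s as a descent; then z is minimal in its
  -- coset, so s ∷ y is reduced.  The bound k is for termination only.
  dihedral-step : ∀ {N} → Strip N → ∀ r s y → IsReduced y → ∀ n z k → length z ℕ.≤ k → length z ℕ.≤ N →
    alt r s (suc n) ++ z ≐ y → suc n ℕ.+ length z ≡ length y →
    (∀ j → suc j ℕ.< suc n → ¬ alt s r (suc j) ≐ alt r s (suc j)) →
    Dihedral r s y ⊎ IsReduced (s ∷ y)
  dihedral-step {N} strip r s y red n z k z≤k z≤N e l nb with braid? s r (suc n)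
  ... | yes b = inj₁ (dihedral n z e b l)
  ... | no ¬b = continue k z≤k (strip (end r s (suc n)) z z≤N red-z)
    where
    red-alt : IsReduced (alt r s (suc n) ++ z)
    red-alt = reduced-resp y (alt r s (suc n) ++ z) (sym e) (≡.trans (≡.sym l) (≡.sym (length-alt-++ r s (suc n) z))) red

    red-z : IsReduced z
    red-z = reduced-++⁻ʳ (alt r s (suc n)) z red-alt

    red-end : IsReduced (end r s n ∷ z)
    red-end = reduced-++⁻ʳ (alt r s n) (end r s n ∷ z) (≡.subst IsReduced
      (≡.trans (≡.cong (_++ z) (alt-∷ʳ r s n)) (++-assoc (alt r s n) _ z)) red-alt)

    nb′ : ∀ j → suc j ℕ.< suc (suc n) → ¬ alt s r (suc j) ≐ alt r s (suc j)
    nb′ j j<n with ℕ.m≤n⇒m<n∨m≡n (ℕ.≤-pred j<n)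
    ... | inj₁ lt     = nb j lt
    ... | inj₂ ≡.refl = ¬b

    continue : ∀ k → length z ℕ.≤ k → Descent (end r s (suc n)) z ⊎ IsReduced (end r s (suc n) ∷ z) →
      Dihedral r s y ⊎ IsReduced (s ∷ y)
    -- The letter stripped last and the one that fails to be a descent of `z` are `r` and `s` in
    -- some order, so both lengthen `z`.
    continue k z≤k (inj₂ red′) with end-both (λ c → IsReduced (c ∷ z)) r s n red-end red′
    ... | red-r , red-s = inj₂ (reduced-resp (s ∷ alt r s (suc n) ++ z) (s ∷ y) (∙-congˡ e)
      (≡.cong suc (≡.trans (length-alt-++ r s (suc n) z) l))
      (alt-reduced red-z red-s red-r (suc (suc n)) nb′))
    continue zero z≤k (inj₁ (z′ , f , g)) with ℕ.≤-trans (ℕ.≤-reflexive g) z≤k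
    ... | ()
    continue (suc k) z≤k (inj₁ (z′ , f , g)) =
      dihedral-step strip r s y red (suc n) z′ k (ℕ.≤-pred (ℕ.≤-trans (ℕ.≤-reflexive g) z≤k))
        (ℕ.≤-trans (ℕ.n≤1+n _) (ℕ.≤-trans (ℕ.≤-reflexive g) z≤N))
        (trans (reflexive (≡.cong eval (≡.trans (≡.cong (_++ z′) (alt-∷ʳ r s (suc n))) (++-assoc (alt r s (suc n)) _ z′))))
          (trans (++-congˡ (alt r s (suc n)) f) e))
        (≡.trans (≡.sym (ℕ.+-suc (suc n) (length z′))) (≡.trans (≡.cong (suc n ℕ.+_) g) l)) nb′

  private
    dihedral-start : ∀ {N} → Strip N → ∀ r s y → length y ℕ.≤ N → IsReduced (r ∷ y) →
      Dihedral r s (r ∷ y) ⊎ IsReduced (s ∷ r ∷ y)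
    dihedral-start strip r s y b red = dihedral-step strip r s (r ∷ y) red 0 y _ ℕ.≤-refl b refl ≡.refl
      λ { _ (s≤s ()) }

    -- Stripping `s` from `r ∷ y` only requires stripping letters from remainders no longer than
    -- `y`. If a braid relation is found, it brings `s` to the front.
    strip-bounded : ∀ N → Strip N
    strip-bounded N       s []      _       _   = inj₂ reduced-[ s ]
    strip-bounded (suc N) s (r ∷ y) (s≤s b) red with dihedral-start (strip-bounded N) r s y b red
    ... | inj₂ red′                   = inj₂ red′
    ... | inj₁ (dihedral n z e f g) = inj₁ (alt r s n ++ z , trans (++-congʳ {alt s r (suc n)} {alt r s (suc n)} z f) e ,
      ≡.trans (≡.cong suc (length-alt-++ r s n z)) g)

  strip : ∀ s y → IsReduced y → Descent s y ⊎ IsReduced (s ∷ y)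
  strip s y = strip-bounded (length y) s y ℕ.≤-refl

  dihedral-exchange : ∀ r s y → IsReduced (r ∷ y) → Dihedral r s (r ∷ y) ⊎ IsReduced (s ∷ r ∷ y)
  dihedral-exchange r s y = dihedral-start (strip-bounded (length y)) r s y ℕ.≤-refl

  reduced-word : ∀ x → ∃[ y ] IsReduced y × y ≐ x
  reduced-word []      = [] , (λ _ _ → z≤n) , refl
  reduced-word (s ∷ x) with reduced-word x
  ... | y , red , e with strip s y red
  ...   | inj₂ red′         = s ∷ y , red′ , ∙-congˡ e
  ...   | inj₁ (y′ , f , g) = y′ , red″ , e′
    where
    e′ : y′ ≐ s ∷ x
    e′ = ι-cancelˡ s (trans f (trans e (sym (ι-cancel s _))))
    red″ : IsReduced y′
    red″ w h = ℕ.≤-pred (≡.subst (ℕ._≤ suc (length w)) (≡.sym g) (red (s ∷ w) (trans (∙-congˡ h) f)))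

  infix 4 _≈?_
  -- A nonempty reduced word cannot represent `ε`, so a reduced word of `g ∙ h ⁻¹` settles the
  -- question.
  _≈?_ : ∀ g h → Dec (g ≈ h)
  g ≈? h with generates (g ∙ h ⁻¹)
  ... | x , e with reduced-word x
  ...   | [] , _ , f    = yes (x∙y⁻¹≈ε⇒x≈y g h (sym (trans f e)))
  ...   | s ∷ y , r , f = no λ g≈h → ¬short (r [] (sym (trans f (trans e (x≈y⇒x∙y⁻¹≈ε g≈h)))))
    where
    ¬short : ¬ (suc (length y) ℕ.≤ 0)
    ¬short ()

-- The Bruhat order through subwords.

module BruhatOrder {c ℓ a} (G : CoxeterGroup c ℓ a) where
  open CoxeterGroup G
  open Bruhat G
  open CoxeterWords G

  reduced⇒isReduced : ∀ {w} x → Reduced w x → IsReduced x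
  reduced⇒isReduced x (e , r) y f = r y (trans f e)

  isReduced⇒reduced : ∀ {w} x → IsReduced x → eval x ≈ w → Reduced w x
  isReduced⇒reduced x r e = e , λ y f → r y (trans f (sym e))

  abstract
    word : ∀ w → ∃[ x ] Reduced w x
    word w with generates w
    ... | x , e with reduced-word x
    ...   | y , r , f = y , isReduced⇒reduced y r (trans f e)

  len : Carrier → ℕ
  len w = length (proj₁ (word w))

  length-unique : ∀ {v w} x y → v ≈ w → Reduced v x → Reduced w y → length x ≡ length y
  length-unique x y e (f , r) (g , r′) =
    ℕ.≤-antisym (r y (trans g (sym e))) (r′ x (trans f e))

  length≡len : ∀ {w} x → Reduced w x → length x ≡ len w
  length≡len {w} x r = length-unique x (proj₁ (word w)) refl r (proj₂ (word w))

  len-cong : ∀ {v w} → v ≈ w → len v ≡ len w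
  len-cong {v} {w} e = length-unique (proj₁ (word v)) (proj₁ (word w)) e (proj₂ (word v)) (proj₂ (word w))

  infix 4 _◁_
  -- The subword may fail to be reduced, which permits recursion on the letters of `y`;
  -- `reduced-subword` leads back to reduced subwords.
  _◁_ : Carrier → List S → Set (ℓ ⊔ a)
  v ◁ y = ∃[ x ] x ⊆ y × eval x ≈ v

  ◁-skip : ∀ {v s y} → v ◁ y → v ◁ s ∷ y
  ◁-skip (x , τ , e) = x , _ ∷⁻ τ , e

  ◁-keep : ∀ {v s y} → ι s ∙ v ◁ y → v ◁ s ∷ y
  ◁-keep {s = s} (x , τ , e) = s ∷ x , ≡.refl ∷ τ , trans (∙-congˡ e) (ι-cancel s _)

  ◁-∷⁻ : ∀ {v s y} → v ◁ s ∷ y → v ◁ y ⊎ ι s ∙ v ◁ y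
  ◁-∷⁻ (x , _ ∷⁻ τ , e) = inj₁ (x , τ , e)
  ◁-∷⁻ {s = s} (_ ∷ x , ≡.refl ∷ τ , e) = inj₂ (x , τ , trans (sym (ι-cancel s _)) (∙-congˡ e))

  _◁?_ : ∀ v y → Dec (v ◁ y)
  v ◁? [] with ε ≈? v
  ... | yes e = yes ([] , [] , e)
  ... | no n  = no λ { ([] , [] , e) → n e }
  v ◁? (s ∷ y) with v ◁? y | (ι s ∙ v) ◁? y
  ... | yes p | _     = yes (◁-skip p)
  ... | no _  | yes q = yes (◁-keep q)
  ... | no n  | no n′ = no λ p → [ n , n′ ]′ (◁-∷⁻ p)

  shorter? : ∀ v y → Dec (∃[ x ] x ⊆ y × length x ℕ.< length y × eval x ≈ v)
  shorter? v []      = no λ { ([] , [] , () , _) }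
  shorter? v (s ∷ y) with v ◁? y | shorter? (ι s ∙ v) y
  ... | yes (x , τ , e) | _ = yes (x , s ∷⁻ τ , s≤s (length-mono-≤ τ) , e)
  ... | no _ | yes (x , τ , l , e) =
    yes (s ∷ x , ≡.refl ∷ τ , s≤s l , trans (∙-congˡ e) (ι-cancel s v))
  ... | no n | no n′ = no λ
    { (x , _ ∷⁻ τ , _ , e) → n (x , τ , e)
    ; (_ ∷ x , ≡.refl ∷ τ , l , e) →
        n′ (x , τ , ℕ.≤-pred l , trans (sym (ι-cancel s _)) (∙-congˡ e)) }

  -- Pass to proper subwords of equal value while there are any. When none is left, no redundant
  -- pair can be deleted, so the word is reduced.
  reduced-subword : ∀ x → ∃[ y ] y ⊆ x × IsReduced y × y ≐ x
  reduced-subword x = go (length x) x ℕ.≤-refl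
    where
    go : ∀ n x → length x ℕ.≤ n → ∃[ y ] y ⊆ x × IsReduced y × y ≐ x
    go n x b with shorter? (eval x) x
    go zero    [] b | yes ([] , [] , () , _)
    go (suc n) x  b | yes (x′ , τ , l , e) with go n x′ (ℕ.≤-pred (ℕ.≤-trans l b))
    ... | y , σ , r , f = y , ⊆-trans σ τ , r , trans f e
    go n x b | no none = x , ⊆-refl , irredundant⇒reduced x (λ (redundant p s q t u x≡ f) →
      none (p ++ q ++ u ,
        ≡.subst (p ++ q ++ u ⊆_) (≡.sym x≡)
          (⊆-++ (⊆-refl {x = p}) (s ∷⁻ ⊆-++ (⊆-refl {x = q}) (t ∷⁻ ⊆-refl))) ,
        ≡.subst (λ y → length (p ++ q ++ u) ℕ.< length y) (≡.sym x≡) (delete-< p s q t u) ,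
        trans (redundant-delete p s q t u f) (reflexive (≡.cong eval (≡.sym x≡))))) , refl

  -- Independence of the chosen reduced word.

  ShortAlt : S → S → ℕ → List S → Set ℓ
  ShortAlt s t n x = ∃[ k ] k ℕ.≤ n × (x ≐ alt s t k ⊎ x ≐ alt t s k)

  ShortAlt-sym : ∀ {s t n} x → ShortAlt s t n x → ShortAlt t s n x
  ShortAlt-sym x (k , b , e) = k , b , swap e

  ShortAlt-∷ : ∀ {s t n} x → ShortAlt s t n x → ShortAlt s t (suc n) (s ∷ x)
  ShortAlt-∷ x (zero  , b , e)      = 1 , s≤s z≤n , inj₁ (∙-congˡ ([ id , id ]′ e))
  ShortAlt-∷ {s} x (suc k , b , inj₁ e) =
    k , ℕ.≤-trans (ℕ.n≤1+n _) (ℕ.≤-trans b (ℕ.n≤1+n _)) , inj₂ (trans (∙-congˡ e) (ι-cancel s _))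
  ShortAlt-∷ x (suc k , b , inj₂ e) = suc (suc k) , s≤s b , inj₁ (∙-congˡ e)

  -- Adjacent equal letters cancel, so a word in two letters collapses to an alternating word that
  -- is no longer.
  shortAlt : ∀ {s t} x → All (λ c → c ≡ s ⊎ c ≡ t) x → ShortAlt s t (length x) x
  shortAlt []      []               = 0 , z≤n , inj₁ refl
  shortAlt (_ ∷ x) (inj₁ ≡.refl ∷ p) = ShortAlt-∷ x (shortAlt x p)
  shortAlt (_ ∷ x) (inj₂ ≡.refl ∷ p) = ShortAlt-sym (_ ∷ x) (ShortAlt-∷ x (ShortAlt-sym x (shortAlt x p)))

  alt-mono : ∀ s t {k n} → k ℕ.≤ n → alt s t k ⊆ alt s t n
  alt-mono s t {n = zero}  z≤n     = []
  alt-mono s t {n = suc n} z≤n     = s ∷⁻ alt-mono t s z≤n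
  alt-mono s t             (s≤s b) = ≡.refl ∷ alt-mono t s b

  -- A proper subword of one alternating word collapses to an alternating word of length less than
  -- `n`, and both such words occur in the other one. The full word is replaced by means of the
  -- braid relation.
  ◁-braid : ∀ {v s t} n z → alt s t n ≐ alt t s n → v ◁ alt s t n ++ z → v ◁ alt t s n ++ z
  ◁-braid {v} {s} {t} n z e (x , τ , f) with ⊆-++⁻ (alt s t n) τ
  ... | d , z′ , ≡.refl , σ , υ = choose (ℕ.m≤n⇒m<n∨m≡n (length-mono-≤ σ))
    where
    whole : ∀ y → y ≐ d → y ⊆ alt t s n → v ◁ alt t s n ++ z
    whole y g ρ = y ++ z′ , ⊆-++ ρ υ , trans (++-congʳ {y} {d} z′ g) f

    proper : ∀ n → length d ℕ.< n → ShortAlt s t (length d) d → ∃[ y ] y ≐ d × y ⊆ alt t s n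
    proper (suc n) (s≤s l) (k , b , inj₁ g) =
      alt s t k , sym g , t ∷⁻ alt-mono s t (ℕ.≤-trans b l)
    proper n l (k , b , inj₂ g) =
      alt t s k , sym g , alt-mono t s (ℕ.≤-trans b (ℕ.<⇒≤ l))

    choose : length d ℕ.< length (alt s t n) ⊎ length d ≡ length (alt s t n) → v ◁ alt t s n ++ z
    choose (inj₂ l) = whole (alt t s n)
      (trans (sym e) (reflexive (≡.cong eval (≡.sym (Pointwise-≡⇒≡ (toPointwise l σ)))))) ⊆-refl
    choose (inj₁ l) with proper n (≡.subst (length d ℕ.<_) (length-alt s t n) l)
      (shortAlt d (All-resp-⊆ σ (alt-all (inj₁ ≡.refl) (inj₂ ≡.refl) n)))
    ... | y , g , ρ = whole y g ρ

  -- Matsumoto's argument: if the first letters r and s differ, both words can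
  -- be made to start with the two alternating words of a braid relation.
  ◁-invariant : ∀ y y′ → IsReduced y → IsReduced y′ → y ≐ y′ → ∀ {v} → v ◁ y → v ◁ y′
  ◁-invariant y y′ = go (length y) y y′ ≡.refl
    where
    go : ∀ n y y′ → length y ≡ n → IsReduced y → IsReduced y′ → y ≐ y′ → ∀ {v} → v ◁ y → v ◁ y′
    go zero    []      _        _ _ _  e ([] , [] , f) = [] , minimum _ , f
    go (suc n) (r ∷ y) []       _ red _ e _ with red [] (sym e)
    ... | ()
    go (suc n) (r ∷ y) (s ∷ y′) l red red′ e p with dihedral-exchange r s y red
    ... | inj₂ red″ = ⊥-elim (ℕ.<-irrefl ≡.refl (ℕ.≤-trans (red″ y′ (ι-cancelˡ s (trans (sym e) (sym (ι-cancel s _)))))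
      (ℕ.≤-trans (ℕ.n≤1+n _) (red′ (r ∷ y) e))))
    ... | inj₁ (dihedral k z f b g) =
      -- Both uses of `same` compare words with a common first letter, where induction applies to
      -- the tails; the first letter changes only in `◁-braid`.
      same s (alt r s k ++ z) y′ (≡.trans (length-alt-++ r s k z) size)
        (reduced-resp (r ∷ y) (alt s r (suc k) ++ z) (sym f′) (size⁺ r s) red)
        red′ (trans f′ e)
        (◁-braid (suc k) z (sym b)
          (same r y (alt s r k ++ z) (ℕ.suc-injective l) red
            (reduced-resp (r ∷ y) (alt r s (suc k) ++ z) (sym f) (size⁺ s r) red)
            (sym f) p))
      where
      size : k ℕ.+ length z ≡ n
      size = ℕ.suc-injective (≡.trans g l)

      size⁺ : ∀ s t → suc (length y) ≡ suc (length (alt s t k ++ z))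
      size⁺ s t = ≡.trans l (≡.cong suc (≡.sym (≡.trans (length-alt-++ s t k z) size)))

      f′ : alt s r (suc k) ++ z ≐ r ∷ y
      f′ = trans (++-congʳ {alt s r (suc k)} {alt r s (suc k)} z b) f

      same : ∀ c x x′ → length x ≡ n → IsReduced (c ∷ x) → IsReduced (c ∷ x′) →
        c ∷ x ≐ c ∷ x′ → ∀ {v} → v ◁ c ∷ x → v ◁ c ∷ x′
      same c x x′ l r r′ e p = [ ◁-skip ∘ rest , ◁-keep ∘ rest ]′ (◁-∷⁻ p)
        where
        rest : ∀ {v} → v ◁ x → v ◁ x′
        rest = go n x x′ l (reduced-++⁻ʳ (c ∷ []) x r) (reduced-++⁻ʳ (c ∷ []) x′ r′) (ι-cancelˡ c e)

  -- The order supplies one particular reduced word of `w`; `◁-invariant` carries the subword over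
  -- to any other.
  ≤⇒◁ : ∀ {v w} y → v ≤ w → Reduced w y → v ◁ y
  ≤⇒◁ y′ (x , y , (e , _) , r , τ) r′ = ◁-invariant y y′ (reduced⇒isReduced y r) (reduced⇒isReduced y′ r′)
    (trans (proj₁ r) (sym (proj₁ r′))) (x , τ , e)

  ◁⇒≤ : ∀ {v w} y → v ◁ y → Reduced w y → v ≤ w
  ◁⇒≤ y (x , τ , e) r with reduced-subword x
  ... | x′ , σ , r′ , f = x′ , y , isReduced⇒reduced x′ r′ (trans f e) , r , ⊆-trans σ τ

  ≤-resp : ∀ {v v′ w w′} → v ≈ v′ → w ≈ w′ → v ≤ w → v′ ≤ w′
  ≤-resp e f (x , y , r , r′ , τ) =
    x , y , isReduced⇒reduced x (reduced⇒isReduced x r) (trans (proj₁ r) e) ,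
    isReduced⇒reduced y (reduced⇒isReduced y r′) (trans (proj₁ r′) f) , τ

  ≤-refl : ∀ {w} → w ≤ w
  ≤-refl {w} with word w
  ... | x , r = x , x , r , r , ⊆-refl

  ≤-reflexive : ∀ {v w} → v ≈ w → v ≤ w
  ≤-reflexive e = ≤-resp refl e ≤-refl

  ≤-trans : ∀ {u v w} → u ≤ v → v ≤ w → u ≤ w
  ≤-trans p (x , y , r , r′ , τ) with ≤⇒◁ x p r
  ... | z , σ , e = ◁⇒≤ y (z , ⊆-trans σ τ , e) r′

  infix 4 _≤?_
  _≤?_ : ∀ v w → Dec (v ≤ w)
  v ≤? w with word w
  ... | y , r with v ◁? y
  ...   | yes p = yes (◁⇒≤ y p r)
  ...   | no n  = no λ p → n (≤⇒◁ y p r)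

  len-mono : ∀ {v w} → v ≤ w → len v ℕ.≤ len w
  len-mono (x , y , r , r′ , τ) = ≡.subst₂ ℕ._≤_ (length≡len x r) (length≡len y r′) (length-mono-≤ τ)

  len-antisym : ∀ {v w} → v ≤ w → len w ℕ.≤ len v → v ≈ w
  len-antisym p@(x , y , r , r′ , τ) b = trans (sym (proj₁ r)) (trans (reflexive (≡.cong eval x≡y)) (proj₁ r′))
    where
    x≡y : x ≡ y
    x≡y = Pointwise-≡⇒≡ (toPointwise (ℕ.≤-antisym (length-mono-≤ τ)
      (≡.subst₂ ℕ._≤_ (≡.sym (length≡len y r′)) (≡.sym (length≡len x r)) b)) τ)

  -- Left descents and the lifting property.

  Down Up : S → Carrier → Set
  Down s w = len w ≡ suc (len (ι s ∙ w))
  Up   s w = len (ι s ∙ w) ≡ suc (len w)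

  up⊎down : ∀ s w → Up s w ⊎ Down s w
  up⊎down s w = go (proj₁ (word w)) (proj₂ (word w))
    where
    go : ∀ y → Reduced w y → Up s w ⊎ Down s w
    go y r with strip s y (reduced⇒isReduced y r)
    ... | inj₁ (y′ , e , l) = inj₂ (≡.trans (≡.sym (length≡len y r)) (≡.trans (≡.sym l) (≡.cong suc (length≡len y′ r′))))
      where
      r′ : Reduced (ι s ∙ w) y′
      r′ = isReduced⇒reduced y′
        (reduced-++⁻ʳ (s ∷ []) y′ (reduced-resp y (s ∷ y′) (sym e) (≡.sym l) (reduced⇒isReduced y r)))
        (ι-cancelˡ s (trans e (trans (proj₁ r) (sym (ι-cancel s w)))))
    ... | inj₂ red = inj₁ (≡.trans (≡.sym (length≡len (s ∷ y) (isReduced⇒reduced (s ∷ y) red (∙-congˡ (proj₁ r)))))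
      (≡.cong suc (length≡len y r)))

  up-down : ∀ {s w} → Up s w → ¬ Down s w
  up-down u d = ℕ.<-irrefl (≡.trans d (≡.cong suc u)) (s≤s (ℕ.n≤1+n _))

  up-cong : ∀ {s v w} → v ≈ w → Up s v → Up s w
  up-cong e u = ≡.trans (len-cong (∙-congˡ (sym e))) (≡.trans u (≡.cong suc (len-cong e)))

  down-cong : ∀ {s v w} → v ≈ w → Down s v → Down s w
  down-cong e d = ≡.trans (len-cong (sym e)) (≡.trans d (≡.cong suc (len-cong (∙-congˡ e))))

  down⇒up : ∀ {s w} → Down s w → Up s (ι s ∙ w)
  down⇒up {s} {w} d = ≡.trans (len-cong (ι-cancel s w)) d

  up⇒down : ∀ {s w} → Up s w → Down s (ι s ∙ w)
  up⇒down {s} {w} u = ≡.trans u (≡.cong suc (≡.sym (len-cong (ι-cancel s w))))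

  down-word : ∀ {s w} → Down s w → ∃[ y ] Reduced (ι s ∙ w) y × Reduced w (s ∷ y)
  down-word {s} {w} d = y , r , isReduced⇒reduced (s ∷ y)
    (reduced-resp x (s ∷ y) (trans (proj₁ r′) (sym e)) d (reduced⇒isReduced x r′)) e
    where
    y  = proj₁ (word (ι s ∙ w))
    r  = proj₂ (word (ι s ∙ w))
    x  = proj₁ (word w)
    r′ = proj₂ (word w)
    e : eval (s ∷ y) ≈ w
    e = trans (∙-congˡ (proj₁ r)) (ι-cancel s w)

  descent : ∀ {n} w → len w ≡ suc n → ∃[ s ] Down s w
  descent {n} w = go (proj₁ (word w)) (proj₂ (word w))
    where
    go : ∀ x → Reduced w x → length x ≡ suc n → ∃[ s ] Down s w
    go (s ∷ y) r _ = s , ≡.trans (≡.sym (length≡len (s ∷ y) r))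
      (≡.cong suc (length≡len y (isReduced⇒reduced y (reduced-++⁻ʳ (s ∷ []) y (reduced⇒isReduced (s ∷ y) r))
        (ι-cancelˡ s (trans (proj₁ r) (sym (ι-cancel s w)))))))

  down-≤ : ∀ {s w} → Down s w → ι s ∙ w ≤ w
  down-≤ {s} d with down-word d
  ... | y , (e , _) , r′ = ◁⇒≤ (s ∷ y) (y , s ∷⁻ ⊆-refl , e) r′

  -- In a reduced word of `w` that begins with `s`, a subword with value `v` either skips this
  -- letter or uses it.
  lifting : ∀ {s v w} → Down s w → v ≤ w → v ≤ ι s ∙ w ⊎ ι s ∙ v ≤ ι s ∙ w
  lifting {s} d p with down-word d
  ... | y , r , r′ = map-⊎ (λ q → ◁⇒≤ y q r) (λ q → ◁⇒≤ y q r) (◁-∷⁻ (≤⇒◁ (s ∷ y) p r′))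

  unlift : ∀ {s v w} → Down s w → ι s ∙ v ≤ ι s ∙ w → v ≤ w
  unlift {s} d p with down-word d
  ... | y , r , r′ = ◁⇒≤ (s ∷ y) (◁-keep (≤⇒◁ y p r)) r′

  -- `v` and `ι s ∙ v` are comparable; knowing which is the larger merges the two alternatives of
  -- `lifting` into one.
  lifting-down : ∀ {s v w} → Down s w → Down s v → v ≤ w → ι s ∙ v ≤ ι s ∙ w
  lifting-down d d′ p = [ ≤-trans (down-≤ d′) , id ]′ (lifting d p)

  lifting-up : ∀ {s v w} → Down s w → Up s v → v ≤ w → v ≤ ι s ∙ w
  lifting-up {s} d u p = [ id , ≤-trans (≤-resp (ι-cancel s _) refl (down-≤ (up⇒down u))) ]′ (lifting d p)

  lifting-up′ : ∀ {s v w} → Down s w → Up s v → v ≤ w → ι s ∙ v ≤ w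
  lifting-up′ {s} d u p = unlift d (≤-resp (sym (ι-cancel s _)) refl (lifting-up d u p))

  -- Gradedness and intervals of length two.

  ≉⇒len< : ∀ {v w} → v ≤ w → ¬ v ≈ w → len v ℕ.< len w
  ≉⇒len< p n = ℕ.≰⇒> λ b → n (len-antisym p b)

  -- Take a descent `s` of `w`. If `s` is an ascent of `u`, then `ι s ∙ w` will do. Otherwise
  -- induction gives a coatom `z` between `ι s ∙ u` and `ι s ∙ w`. It lifts to `ι s ∙ z` if `s` is
  -- an ascent of `z`; if not, `u` lies below `z`, and `ι s ∙ w` will do again.
  coatom : ∀ {u w} → u ≤ w → ¬ u ≈ w → ∃[ z ] u ≤ z × z ≤ w × len w ≡ suc (len z)
  coatom {w = w} = go (len w) ≡.refl
    where
    go : ∀ n {u w} → len w ≡ n → u ≤ w → ¬ u ≈ w → ∃[ z ] u ≤ z × z ≤ w × len w ≡ suc (len z)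
    go zero l p n with ≡.subst (_ ℕ.<_) l (≉⇒len< p n)
    ... | ()
    go (suc n) {u} {w} l p u≉w with descent w l
    ... | s , d with up⊎down s u
    ...   | inj₁ up = ι s ∙ w , lifting-up d up p , down-≤ d , d
    ...   | inj₂ dn with go n (ℕ.suc-injective (≡.trans (≡.sym d) l)) (lifting-down d dn p) (u≉w ∘ ι-cancelˡ s)
    ...     | z , q , q′ , k with up⊎down s z
    ...       | inj₁ up = ι s ∙ z , unlift (up⇒down up) (≤-resp refl (sym (ι-cancel s z)) q) ,
      unlift d (≤-resp (sym (ι-cancel s z)) refl q′) , ≡.trans d (≡.cong suc (≡.trans k (≡.sym up)))
    ...       | inj₂ dz = ι s ∙ w ,
      ≤-trans (≤-resp (ι-cancel s u) refl (lifting-up′ dz (down⇒up dn) q)) q′ , down-≤ d , d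

  Middle : Carrier → Carrier → Carrier → Set (ℓ ⊔ a)
  Middle u w x = u ≤ x × x ≤ w × len x ≡ suc (len u)

  record Diamond (u w : Carrier) : Set (c ⊔ ℓ ⊔ a) where
    field
      x₁ x₂    : Carrier
      middle₁  : Middle u w x₁
      middle₂  : Middle u w x₂
      distinct : ¬ x₁ ≈ x₂
      only     : ∀ {x} → Middle u w x → x ≈ x₁ ⊎ x ≈ x₂

  -- A middle element with ascent `s` lies below `ι s ∙ w` and has the same length. For one with
  -- descent `s`, removing `s` gives an element above `u` of the same length as `u`.
  diamond-up : ∀ {s u w} → Down s w → Up s u → u ≤ w → len w ≡ suc (suc (len u)) → Diamond u w
  diamond-up {s} {u} {w} d up p k = record
    { x₁       = ι s ∙ u
    ; x₂       = ι s ∙ w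
    ; middle₁  = ≤-resp (ι-cancel s u) refl (down-≤ (up⇒down up)) , lifting-up′ d up p , up
    ; middle₂  = lifting-up d up p , down-≤ d , len-sw
    ; distinct = λ e → ℕ.<-irrefl (len-cong (ι-cancelˡ s e))
        (≡.subst (len u ℕ.<_) (≡.sym k) (s≤s (ℕ.n≤1+n _)))
    ; only     = only
    }
    where
    len-sw : len (ι s ∙ w) ≡ suc (len u)
    len-sw = ℕ.suc-injective (≡.trans (≡.sym d) k)

    only : ∀ {x} → Middle u w x → x ≈ ι s ∙ u ⊎ x ≈ ι s ∙ w
    only {x} (q , q′ , j) with up⊎down s x
    ... | inj₁ ux = inj₂ (len-antisym (lifting-up d ux q′) (ℕ.≤-reflexive (≡.trans len-sw (≡.sym j))))
    ... | inj₂ dx = inj₁ (trans (sym (ι-cancel s x)) (∙-congˡ (sym (len-antisym (lifting-up dx up q)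
      (ℕ.≤-reflexive (ℕ.suc-injective (≡.trans (≡.sym dx) j)))))))

  -- If s is a descent of u as well, then multiplication by s matches the middle
  -- elements of [su, sw] with those of [u, w], except that u, if it lies in
  -- [su, sw], corresponds to sw.
  module _ {s u w} (d : Down s w) (dn : Down s u) (k : len w ≡ suc (suc (len u))) where
    private
      len-sw : len (ι s ∙ w) ≡ suc (len u)
      len-sw = ℕ.suc-injective (≡.trans (≡.sym d) k)

      Middle′ : Carrier → Set (ℓ ⊔ a)
      Middle′ = Middle (ι s ∙ u) (ι s ∙ w)

      Corresponds : Carrier → Carrier → Set ℓ
      Corresponds x′ x = (Up s x′ × x ≈ ι s ∙ x′) ⊎ (x′ ≈ u × x ≈ ι s ∙ w)

      image : ∀ {x′} → Middle′ x′ → ∃[ x ] Middle u w x × Corresponds x′ x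
      image {x′} (q , q′ , j) with up⊎down s x′
      ... | inj₁ ux = ι s ∙ x′ ,
        (unlift (up⇒down ux) (≤-resp refl (sym (ι-cancel s x′)) q) ,
         unlift d (≤-resp (sym (ι-cancel s x′)) refl q′) ,
         ≡.trans ux (≡.cong suc (≡.trans j (≡.sym dn)))) , inj₁ (ux , refl)
      ... | inj₂ dx = ι s ∙ w , (≤-resp x′≈u refl q′ , down-≤ d , len-sw) , inj₂ (x′≈u , refl)
        where
        x′≈u : x′ ≈ u
        x′≈u = sym (len-antisym (≤-resp (ι-cancel s u) refl (lifting-up′ dx (down⇒up dn) q))
          (ℕ.≤-reflexive (≡.trans j (≡.sym dn))))

      mixed : ∀ {x′ x} → x′ ≤ ι s ∙ w → x ≈ ι s ∙ x′ → ¬ x ≈ ι s ∙ w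
      mixed q e f = ℕ.<-irrefl (len-cong (ι-cancelˡ s (trans (sym e) f)))
        (ℕ.≤-trans (s≤s (len-mono q)) (ℕ.≤-reflexive (≡.sym d)))

      separate : ∀ {x₁ x₂ y₁ y₂} → ¬ x₁ ≈ x₂ → Middle′ x₁ → Middle′ x₂ →
        Corresponds x₁ y₁ → Corresponds x₂ y₂ → ¬ y₁ ≈ y₂
      separate n _ _ (inj₁ (_ , e)) (inj₁ (_ , f)) g = n (ι-cancelˡ s (trans (sym e) (trans g f)))
      separate n _ _ (inj₂ (e , _)) (inj₂ (f , _)) g = n (trans e (sym f))
      separate n (_ , q , _) _ (inj₁ (_ , e)) (inj₂ (_ , f)) g = mixed q e (trans g f)
      separate n _ (_ , q , _) (inj₂ (_ , e)) (inj₁ (_ , f)) g = mixed q f (trans (sym g) e)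

      up-case : ∀ {x x′ y} → Down s x → ι s ∙ x ≈ x′ → Corresponds x′ y → x ≈ y
      up-case {x} dx e (inj₁ (_ , f)) = trans (sym (ι-cancel s x)) (trans (∙-congˡ e) (sym f))
      up-case {x} dx e (inj₂ (f , _)) = ⊥-elim (up-down {s} {u} (up-cong (trans e f) (down⇒up dx)) dn)

      down-case : ∀ {x x′ y} → x ≈ ι s ∙ w → u ≈ x′ → Corresponds x′ y → x ≈ y
      down-case {x′ = x′} e f (inj₁ (ux , _)) = ⊥-elim (up-down {s} {x′} ux (down-cong f dn))
      down-case e f (inj₂ (_ , g))  = trans e (sym g)

      -- If `s` is a descent of `x`, then `ι s ∙ x` is a middle element of the smaller interval. If
      -- it is an ascent, then `x` is `ι s ∙ w`, and `u` is the corresponding middle element.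
      cover : ∀ {x₁ x₂ y₁ y₂ x} → (∀ {x} → Middle′ x → x ≈ x₁ ⊎ x ≈ x₂) →
        Corresponds x₁ y₁ → Corresponds x₂ y₂ → Middle u w x → x ≈ y₁ ⊎ x ≈ y₂
      cover {x = x} only c₁ c₂ (q , q′ , j) with up⊎down s x
      ... | inj₂ dx = map-⊎ (λ e → up-case dx e c₁) (λ e → up-case dx e c₂)
        (only (lifting-down dx dn q , lifting-down d dx q′ ,
          ℕ.suc-injective (≡.trans (≡.sym dx) (≡.trans j (≡.cong suc dn)))))
      ... | inj₁ ux = map-⊎ (λ e → down-case x≈sw e c₁) (λ e → down-case x≈sw e c₂)
        (only (down-≤ dn , ≤-resp refl x≈sw q , dn))
        where
        x≈sw : x ≈ ι s ∙ w
        x≈sw = len-antisym (lifting-up d ux q′) (ℕ.≤-reflexive (≡.trans len-sw (≡.sym j)))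

    diamond-down : Diamond (ι s ∙ u) (ι s ∙ w) → Diamond u w
    diamond-down D with image (Diamond.middle₁ D) | image (Diamond.middle₂ D)
    ... | y₁ , m₁ , c₁ | y₂ , m₂ , c₂ = record
      { x₁       = y₁
      ; x₂       = y₂
      ; middle₁  = m₁
      ; middle₂  = m₂
      ; distinct = separate D.distinct D.middle₁ D.middle₂ c₁ c₂
      ; only     = cover D.only c₁ c₂
      }
      where module D = Diamond D

  diamond : ∀ {u w} → u ≤ w → len w ≡ suc (suc (len u)) → Diamond u w
  diamond {w = w} = go (len w) ≡.refl
    where
    go : ∀ n {u w} → len w ≡ n → u ≤ w → len w ≡ suc (suc (len u)) → Diamond u w
    go zero l p k with ≡.trans (≡.sym l) k
    ... | ()
    go (suc n) {u} {w} l p k with descent w l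
    ... | s , d with up⊎down s u
    ...   | inj₁ up = diamond-up d up p k
    ...   | inj₂ dn = diamond-down d dn k
      (go n (ℕ.suc-injective (≡.trans (≡.sym d) l)) (lifting-down d dn p)
        (ℕ.suc-injective (≡.trans (≡.sym d) (≡.trans k (≡.cong (λ i → suc (suc i)) dn)))))

-- Thin graded posets and modular lattices.

head-⊆ : ∀ {n} {A B : Subset n} {s t} → s ∷ A ⊆ₛ t ∷ B → s ≡ true → t ≡ true
head-⊆ p ≡.refl with p here
... | here = ≡.refl

-- What the lattice argument retains of a Bruhat interval. The least element may have any rank, so
-- Coxeter length can serve as it is.
record ThinGrading {c ℓ₁ ℓ₂} (P : RawRelation c ℓ₁ ℓ₂) : Set (c ⊔ ℓ₁ ⊔ ℓ₂) where
  open RawRelation P renaming (_∼_ to infix 4 _≤_)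

  field
    _≤?_         : ∀ x y → Dec (x ≤ y)
    rank         : Carrier → ℕ
    rank-mono    : ∀ {x y} → x ≤ y → rank x ℕ.≤ rank y
    rank-antisym : ∀ {x y} → x ≤ y → rank y ℕ.≤ rank x → x ≈ y
    coatom       : ∀ {x y} → x ≤ y → ¬ x ≈ y → ∃[ z ] x ≤ z × z ≤ y × rank y ≡ suc (rank z)

  Middle : Carrier → Carrier → Carrier → Set ℓ₂
  Middle x z y = x ≤ y × y ≤ z × rank y ≡ suc (rank x)

  field
    diamond : ∀ {x z} → x ≤ z → rank z ≡ suc (suc (rank x)) →
      ∃[ y₁ ] ∃[ y₂ ] Middle x z y₁ × Middle x z y₂ × ¬ y₁ ≈ y₂ ×
      (∀ {y} → Middle x z y → y ≈ y₁ ⊎ y ≈ y₂)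

module ThinModularLattice {c ℓ₁ ℓ₂} {P : RawRelation c ℓ₁ ℓ₂}
  (L : IsModularLattice P) (T : ThinGrading P) where
  open RawRelation P using (Carrier; _≈_) renaming (_∼_ to infix 4 _≤_)
  open IsModularLattice L
  open IsLattice isLattice using (module Eq; antisym; x≤x∨y; y≤x∨y; ∨-least; x∧y≤x; x∧y≤y; ∧-greatest)
    renaming (reflexive to ≤-reflexive; refl to ≤-refl; trans to ≤-trans)
  open ThinGrading T

  ≥-reflexive : ∀ {x y} → x ≈ y → y ≤ x
  ≥-reflexive e = ≤-reflexive (Eq.sym e)

  rank-cong : ∀ {x y} → x ≈ y → rank x ≡ rank y
  rank-cong e = ℕ.≤-antisym (rank-mono (≤-reflexive e)) (rank-mono (≥-reflexive e))

  rank-≈ : ∀ {x y} → x ≤ y → rank x ≡ rank y → x ≈ y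
  rank-≈ p e = rank-antisym p (ℕ.≤-reflexive (≡.sym e))

  infix 4 _≈?_
  _≈?_ : ∀ x y → Dec (x ≈ y)
  x ≈? y with x ≤? y | y ≤? x
  ... | yes p | yes q = yes (antisym p q)
  ... | no n  | _     = no (n ∘ ≤-reflexive)
  ... | yes _ | no n  = no (n ∘ ≥-reflexive)

  infix 4 _⋖_
  _⋖_ : Carrier → Carrier → Set ℓ₂
  x ⋖ y = x ≤ y × rank y ≡ suc (rank x)

  ⋖-cases : ∀ {x y p} → x ⋖ y → x ≤ p → p ≤ y → p ≈ x ⊎ p ≈ y
  ⋖-cases (_ , e) q r with ℕ.m≤n⇒m<n∨m≡n (ℕ.≤-trans (rank-mono r) (ℕ.≤-reflexive e))
  ... | inj₁ l = inj₁ (Eq.sym (rank-antisym q (ℕ.≤-pred l)))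
  ... | inj₂ f = inj₂ (rank-≈ r (≡.trans f (≡.sym e)))

  -- Apply the alternative to a coatom of `[x, y]`: it cannot lie above `y`, so it is `x`.
  ⋖-intro : ∀ {x y} → x ≤ y → ¬ x ≈ y → (∀ p → x ≤ p → p ≤ y → p ≤ x ⊎ y ≤ p) → x ⋖ y
  ⋖-intro {x} {y} x≤y n f with coatom x≤y n
  ... | z , q , r , e with f z q r
  ...   | inj₁ z≤x = x≤y , ≡.trans e (≡.cong suc (rank-cong (antisym z≤x q)))
  ...   | inj₂ y≤z = ⊥-elim (ℕ.<-irrefl ≡.refl (ℕ.≤-trans (ℕ.≤-reflexive (≡.sym e)) (rank-mono y≤z)))

  -- For `p` in `[x ∧ y, x]`, the join `p ∨ y` is `y` or `z`. In the first case `p` is `x ∧ y`; in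
  -- the second the modular law recovers `p` as `x`.
  ⋖-∧ : ∀ {x y z} → y ⋖ z → x ≤ z → ¬ x ≤ y → x ∧ y ⋖ x
  ⋖-∧ {x} {y} {z} c x≤z x≰y = ⋖-intro (x∧y≤x x y) (λ e → x≰y (≤-trans (≥-reflexive e) (x∧y≤y x y))) λ p q r →
    map-⊎ (λ e → ∧-greatest r (≤-trans (x≤x∨y p y) (≤-reflexive e)))
      (λ e → ≤-trans (∧-greatest (≤-trans x≤z (≥-reflexive e)) ≤-refl)
        (≤-trans (≥-reflexive (modular p y x r))
          (∨-least ≤-refl (≤-trans (∧-greatest (x∧y≤y y x) (x∧y≤x y x)) q))))
      (⋖-cases c (y≤x∨y p y) (∨-least (≤-trans r x≤z) (proj₁ c)))

  module _ {b a} (b⋖a : b ⋖ a) where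

    a≰b : ¬ a ≤ b
    a≰b p = ℕ.<-irrefl ≡.refl (ℕ.≤-trans (ℕ.≤-reflexive (≡.sym (proj₂ b⋖a))) (rank-mono p))

    -- Dually, for `p` in `[x, x ∨ a]` the meet `a ∧ p` is `b` or `a`; the modular law gives `p ≈ x`
    -- in the first case.
    ⋖-∨ : ∀ {x} → b ≤ x → ¬ a ≤ x → x ⋖ x ∨ a
    ⋖-∨ {x} b≤x a≰x = ⋖-intro (x≤x∨y x a) (λ e → a≰x (≤-trans (y≤x∨y x a) (≥-reflexive e))) between
      where
      between : ∀ p → x ≤ p → p ≤ x ∨ a → p ≤ x ⊎ x ∨ a ≤ p
      between p q r with ⋖-cases b⋖a (∧-greatest (proj₁ b⋖a) (≤-trans b≤x q)) (x∧y≤x a p)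
      ... | inj₁ e = inj₁ (≤-trans (∧-greatest r ≤-refl) (≤-trans (≥-reflexive (modular x a p q))
        (∨-least ≤-refl (≤-trans (≤-reflexive e) b≤x))))
      ... | inj₂ e = inj₂ (∨-least q (≤-trans (≥-reflexive e) (x∧y≤y a p)))

    -- If x and y were distinct, then x, y and (x ∧ y) ∨ a would be three
    -- elements strictly between x ∧ y and x ∨ a.
    ∨-injective : ∀ {x y} → b ≤ x → b ≤ y → ¬ a ≤ x → ¬ a ≤ y → x ∨ a ≈ y ∨ a → x ≈ y
    ∨-injective {x} {y} b≤x b≤y a≰x a≰y e with x ≈? y
    ... | yes x≈y = x≈y
    ... | no x≉y = ⊥-elim impossible
      where
      z = y ∨ a
      u = x ∧ y

      rank-x : rank x ≡ rank y
      rank-x = ℕ.suc-injective (≡.trans (≡.sym (proj₂ (⋖-∨ b≤x a≰x)))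
        (≡.trans (rank-cong e) (proj₂ (⋖-∨ b≤y a≰y))))

      x≤z : x ≤ z
      x≤z = ≤-trans (x≤x∨y x a) (≤-reflexive e)

      u⋖x : u ⋖ x
      u⋖x = ⋖-∧ (⋖-∨ b≤y a≰y) x≤z (λ p → x≉y (rank-≈ p rank-x))

      u⋖u∨a : u ⋖ u ∨ a
      u⋖u∨a = ⋖-∨ (∧-greatest b≤x b≤y) (λ p → a≰x (≤-trans p (x∧y≤x x y)))

      impossible : ⊥
      impossible with diamond {u} {z} (≤-trans (x∧y≤x x y) x≤z)
        (≡.trans (proj₂ (⋖-∨ b≤y a≰y)) (≡.cong suc (≡.trans (≡.sym rank-x) (proj₂ u⋖x))))
      ... | _ , _ , _ , _ , _ , only = two
        (only (x∧y≤x x y , x≤z , proj₂ u⋖x))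
        (only (x∧y≤y x y , x≤x∨y y a , ≡.trans (≡.sym rank-x) (proj₂ u⋖x)))
        (only (x≤x∨y u a , ∨-least (≤-trans (x∧y≤x x y) x≤z) (y≤x∨y y a) , proj₂ u⋖u∨a))
        where
        x≢ : ∀ {p} → x ≈ p → ¬ u ∨ a ≈ p
        x≢ f g = a≰x (≤-trans (y≤x∨y u a) (≤-trans (≤-reflexive g) (≥-reflexive f)))
        y≢ : ∀ {p} → y ≈ p → ¬ u ∨ a ≈ p
        y≢ f g = a≰y (≤-trans (y≤x∨y u a) (≤-trans (≤-reflexive g) (≥-reflexive f)))

        two : ∀ {p q} → x ≈ p ⊎ x ≈ q → y ≈ p ⊎ y ≈ q → u ∨ a ≈ p ⊎ u ∨ a ≈ q → ⊥
        two (inj₁ f) (inj₁ g) _        = x≉y (Eq.trans f (Eq.sym g))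
        two (inj₂ f) (inj₂ g) _        = x≉y (Eq.trans f (Eq.sym g))
        two (inj₁ f) _        (inj₁ h) = x≢ f h
        two (inj₂ f) _        (inj₂ h) = x≢ f h
        two _        (inj₁ g) (inj₁ h) = y≢ g h
        two _        (inj₂ g) (inj₂ h) = y≢ g h

    -- Apply `∨-injective` to `x` and `y ∧ (x ∨ a)`: by the modular law the latter has the join
    -- `x ∨ a` with `a`.
    ∨-cancel : ∀ {x y} → b ≤ x → b ≤ y → ¬ a ≤ x → ¬ a ≤ y → x ∨ a ≤ y ∨ a → x ≤ y
    ∨-cancel {x} {y} b≤x b≤y a≰x a≰y p =
      ≤-trans (≤-reflexive (∨-injective b≤x (∧-greatest b≤y (≤-trans b≤x (x≤x∨y x a))) a≰x
        (λ q → a≰y (≤-trans q (x∧y≤x y (x ∨ a)))) same)) (x∧y≤x y (x ∨ a))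
      where
      u = y ∧ (x ∨ a)
      same : x ∨ a ≈ u ∨ a
      same = antisym
        (≤-trans (∧-greatest (≤-trans p (∨-least (y≤x∨y a y) (x≤x∨y a y))) ≤-refl)
          (≤-trans (≥-reflexive (modular a y (x ∨ a) (y≤x∨y x a))) (∨-least (y≤x∨y u a) (x≤x∨y u a))))
        (∨-least (x∧y≤y y (x ∨ a)) (y≤x∨y x a))

    -- Induction along a coatom `z′` of `z` above `a`. If `x` is a solution for `z′`, then `[x, z]`
    -- has length two, and its middle element other than `z′` is a solution for `z`: were it above
    -- `a`, it would be above `x ∨ a`, which is `z′`.
    relative-complement : ∀ {z} → a ≤ z → ∃[ x ] b ≤ x × ¬ a ≤ x × x ∨ a ≈ z
    relative-complement {z} = go (rank z) ≡.refl
      where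
      go : ∀ n {z} → rank z ≡ n → a ≤ z → ∃[ x ] b ≤ x × ¬ a ≤ x × x ∨ a ≈ z
      go n {z} l a≤z with a ≈? z
      ... | yes a≈z = b , ≤-refl , a≰b ,
        Eq.trans (antisym (∨-least (proj₁ b⋖a) ≤-refl) (y≤x∨y b a)) a≈z
      ... | no a≉z with coatom a≤z a≉z
      go zero    l a≤z | no a≉z | z′ , a≤z′ , z′≤z , e with ≡.trans (≡.sym l) e
      ... | ()
      go (suc n) {z} l a≤z | no a≉z | z′ , a≤z′ , z′≤z , e
        with go n (ℕ.suc-injective (≡.trans (≡.sym e) l)) a≤z′
      ... | x , b≤x , a≰x , f = extend (diamond x≤z rank-z)
        where
        x≤z′ : x ≤ z′
        x≤z′ = ≤-trans (x≤x∨y x a) (≤-reflexive f)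

        x≤z : x ≤ z
        x≤z = ≤-trans x≤z′ z′≤z

        rank-z′ : rank z′ ≡ suc (rank x)
        rank-z′ = ≡.trans (rank-cong (Eq.sym f)) (proj₂ (⋖-∨ b≤x a≰x))

        rank-z : rank z ≡ suc (suc (rank x))
        rank-z = ≡.trans e (≡.cong suc rank-z′)

        other : ∀ {y} → Middle x z y → ¬ y ≈ z′ → ∃[ x ] b ≤ x × ¬ a ≤ x × x ∨ a ≈ z
        other {y} (x≤y , y≤z , r) y≉z′ = y , b≤y , a≰y ,
          rank-≈ (∨-least y≤z a≤z) (≡.trans (proj₂ (⋖-∨ b≤y a≰y)) (≡.trans (≡.cong suc r) (≡.sym rank-z)))
          where
          b≤y : b ≤ y
          b≤y = ≤-trans b≤x x≤y
          a≰y : ¬ a ≤ y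
          a≰y a≤y = y≉z′ (Eq.sym (rank-≈ (≤-trans (≥-reflexive f) (∨-least x≤y a≤y)) (≡.trans rank-z′ (≡.sym r))))

        extend : ∃[ y₁ ] ∃[ y₂ ] Middle x z y₁ × Middle x z y₂ × ¬ y₁ ≈ y₂ ×
          (∀ {y} → Middle x z y → y ≈ y₁ ⊎ y ≈ y₂) → ∃[ x ] b ≤ x × ¬ a ≤ x × x ∨ a ≈ z
        extend (y₁ , y₂ , m₁ , m₂ , n , only) with only (x≤z′ , z′≤z , rank-z′)
        ... | inj₁ z′≈y₁ = other m₂ (λ g → n (Eq.sym (Eq.trans g z′≈y₁)))
        ... | inj₂ z′≈y₂ = other m₁ (λ g → n (Eq.trans g z′≈y₂))

  -- Coordinates obtained by splitting off atoms.

  atom : ∀ n {x y} → x ≤ y → rank y ≡ suc n ℕ.+ rank x → ∃[ a ] x ⋖ a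
  atom zero    {y = y} p e = y , p , e
  atom (suc n) {x} p e with coatom p (λ f → ℕ.<-irrefl (rank-cong f)
    (≡.subst (rank x ℕ.<_) (≡.sym e) (s≤s (ℕ.m≤n+m _ _))))
  ... | z , q , _ , f = atom n q (ℕ.suc-injective (≡.trans (≡.sym f) e))

  -- An order isomorphism from the elements above `b` onto the subsets of an `n`-element set. The
  -- map is defined everywhere and its laws are restricted to elements above `b`, which avoids
  -- forming a subtype.
  record Coordinates (b : Carrier) (n : ℕ) : Set (c ⊔ ℓ₁ ⊔ ℓ₂) where
    field
      to     : Carrier → Subset n
      mono   : ∀ {x y} → b ≤ x → x ≤ y → to x ⊆ₛ to y
      cancel : ∀ {x y} → b ≤ x → b ≤ y → to x ⊆ₛ to y → x ≤ y
      onto   : ∀ A → ∃[ x ] b ≤ x × to x ≡ A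

    cong : ∀ {x y} → b ≤ x → x ≈ y → to x ≡ to y
    cong p e = ⊆ₛ-antisym (mono p (≤-reflexive e)) (mono (≤-trans p (≤-reflexive e)) (≥-reflexive e))

  -- Splitting off an atom a of [b, 1]: the map x ↦ ([a ≤ x], x ∨ a) is an
  -- isomorphism from [b, 1] onto the product of a two-element chain and [a, 1].
  split-atom : ∀ {b a n} → b ⋖ a → Coordinates a n → Coordinates b (suc n)
  split-atom {b} {a} {n} b⋖a C = record { to = to ; mono = mono ; cancel = cancel ; onto = onto }
    where
    module C = Coordinates C

    to : Carrier → Subset (suc n)
    to x = does (a ≤? x) ∷ C.to (x ∨ a)

    mono : ∀ {x y} → b ≤ x → x ≤ y → to x ⊆ₛ to y
    mono {x} {y} b≤x x≤y with a ≤? x | a ≤? y | C.mono (y≤x∨y x a) (∨-least (≤-trans x≤y (x≤x∨y y a)) (y≤x∨y y a))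
    ... | no _  | _     | p = out⊆ p
    ... | yes _ | yes _ | p = in⊆in p
    ... | yes q | no n  | _ = ⊥-elim (n (≤-trans q x≤y))

    cancel : ∀ {x y} → b ≤ x → b ≤ y → to x ⊆ₛ to y → x ≤ y
    cancel {x} {y} b≤x b≤y p with C.cancel (y≤x∨y x a) (y≤x∨y y a) (drop-∷-⊆ p) | a ≤? x | a ≤? y
    ... | q | _     | yes r = ≤-trans (x≤x∨y x a) (≤-trans q (∨-least ≤-refl r))
    ... | q | no n  | no n′ = ∨-cancel b⋖a b≤x b≤y n n′ q
    ... | q | yes r | no n′ with ≡.trans (≡.sym (head-⊆ p (dec-true (a ≤? x) r))) (dec-false (a ≤? y) n′)
    ...   | ()

    onto : ∀ A → ∃[ x ] b ≤ x × to x ≡ A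
    onto (true ∷ A) with C.onto A
    ... | z , a≤z , e = z , ≤-trans (proj₁ b⋖a) a≤z , ≡.cong₂ _∷_ (dec-true (a ≤? z) a≤z)
      (≡.trans (C.cong (y≤x∨y z a) (antisym (∨-least ≤-refl a≤z) (x≤x∨y z a))) e)
    onto (false ∷ A) with C.onto A
    ... | z , a≤z , e with relative-complement b⋖a a≤z
    ...   | x , b≤x , a≰x , f = x , b≤x , ≡.cong₂ _∷_ (dec-false (a ≤? x) a≰x)
      (≡.trans (C.cong (y≤x∨y x a) f) e)

  module _ {⊤} (maximum : ∀ x → x ≤ ⊤) where

    -- Induction on the corank of `b`; at corank zero `b` equals the maximum and a single point
    -- remains.
    coordinates : ∀ n b → rank ⊤ ≡ n ℕ.+ rank b → Coordinates b n
    coordinates zero b e = record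
      { to     = λ _ → []
      ; mono   = λ _ _ → ⊆ₛ-refl
      ; cancel = λ _ b≤y _ → ≤-trans (≤-trans (maximum _) (≥-reflexive (rank-≈ (maximum b) (≡.sym e)))) b≤y
      ; onto   = λ { [] → b , ≤-refl , ≡.refl }
      }
    coordinates (suc n) b e with atom n (maximum b) e
    ... | a , b⋖a = split-atom b⋖a (coordinates n a
      (≡.trans e (≡.trans (≡.sym (ℕ.+-suc n (rank b))) (≡.cong (n ℕ.+_) (≡.sym (proj₂ b⋖a))))))

    isBoolean : ∀ {⊥} → (∀ x → ⊥ ≤ x) → IsBoolean P
    isBoolean {⊥} minimum = n , C.to , record
      { isOrderMonomorphism = record
        { isOrderHomomorphism = record
          { cong = C.cong (minimum _)
          ; mono = C.mono (minimum _)
          }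
        ; injective = λ e → antisym (reflect (⊆ₛ-reflexive e)) (reflect (⊆ₛ-reflexive (≡.sym e)))
        ; cancel    = reflect
        }
      ; surjective = λ A → let x , _ , e = C.onto A in x , λ f → ≡.trans (C.cong (minimum _) f) e
      }
      where
      n = rank ⊤ ℕ.∸ rank ⊥
      module C = Coordinates (coordinates n ⊥ (≡.sym (ℕ.m∸n+n≡m (rank-mono (maximum ⊥)))))
      reflect : ∀ {x y} → C.to x ⊆ₛ C.to y → x ≤ y
      reflect = C.cancel (minimum _) (minimum _)

-- Boolean posets are modular lattices.

-- All laws, those of a partial order included, are pulled back from subsets along the isomorphism;
-- there the modular law follows from distributivity.
boolean⇒modular : ∀ {c ℓ₁ ℓ₂} (P : RawRelation c ℓ₁ ℓ₂) → IsBoolean P → IsModularLattice P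
boolean⇒modular P (n , f , iso) = record
  { _∨_       = λ x y → g (f x ∪ f y)
  ; _∧_       = λ x y → g (f x ∩ f y)
  ; isLattice = record
    { isPartialOrder = record
      { isPreorder = record
        { isEquivalence = record
          { refl  = injective ≡.refl
          ; sym   = λ e → injective (≡.sym (cong e))
          ; trans = λ e e′ → injective (≡.trans (cong e) (cong e′))
          }
        ; reflexive = λ e → cancel (⊆ₛ-reflexive (cong e))
        ; trans     = λ p q → cancel (⊆ₛ-trans (mono p) (mono q))
        }
      ; antisym = λ p q → injective (⊆ₛ-antisym (mono p) (mono q))
      }
    ; supremum = λ x y →
        cancel (≡.subst (f x ⊆ₛ_) (≡.sym (f∘g _)) (p⊆p∪q (f y))) ,
        cancel (≡.subst (f y ⊆ₛ_) (≡.sym (f∘g _)) (q⊆p∪q (f x) (f y))) ,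
        λ z p q → cancel (≡.subst (_⊆ₛ f z) (≡.sym (f∘g _))
          λ i → [ mono p , mono q ]′ (x∈p∪q⁻ (f x) (f y) i))
    ; infimum = λ x y →
        cancel (≡.subst (_⊆ₛ f x) (≡.sym (f∘g _)) (p∩q⊆p (f x) (f y))) ,
        cancel (≡.subst (_⊆ₛ f y) (≡.sym (f∘g _)) (p∩q⊆q (f x) (f y))) ,
        λ z p q → cancel (≡.subst (f z ⊆ₛ_) (≡.sym (f∘g _)) λ i → x∈p∩q⁺ (mono p i , mono q i))
    }
  ; modular = λ x y z p → injective (begin
      f (g (f x ∪ f (g (f y ∩ f z))))  ≡⟨ f∘g _ ⟩
      f x ∪ f (g (f y ∩ f z))          ≡⟨ ≡.cong (f x ∪_) (f∘g _) ⟩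
      f x ∪ (f y ∩ f z)                ≡⟨ ∪-distribˡ-∩ (f x) (f y) (f z) ⟩
      (f x ∪ f y) ∩ (f x ∪ f z)        ≡⟨ ≡.cong ((f x ∪ f y) ∩_) (absorb (mono p)) ⟩
      (f x ∪ f y) ∩ f z                ≡⟨ ≡.cong (_∩ f z) (f∘g _) ⟨
      f (g (f x ∪ f y)) ∩ f z          ≡⟨ f∘g _ ⟨
      f (g (f (g (f x ∪ f y)) ∩ f z))  ∎)
  }
  where
  open RawRelation P renaming (_∼_ to _≤_)
  open IsOrderIsomorphism iso
  open ≡-Reasoning

  g : Subset n → Carrier
  g A = proj₁ (surjective A)

  f∘g : ∀ A → f (g A) ≡ A
  f∘g A = proj₂ (surjective A) (injective ≡.refl)

  absorb : ∀ {A B} → A ⊆ₛ B → A ∪ B ≡ B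
  absorb {A} {B} p = ⊆ₛ-antisym (λ i → [ p , id ]′ (x∈p∪q⁻ A B i)) (q⊆p∪q A B)

-- Application to Bruhat intervals.

module _ {c ℓ a} (G : CoxeterGroup c ℓ a) (v w : CoxeterGroup.Carrier G) where
  open CoxeterGroup G
  open Bruhat G
  open BruhatOrder G

  -- Intervals are convex, so the coatoms and middle elements found in the whole group lie in
  -- `[v, w]` again.
  interval-thin : ThinGrading (interval v w)
  interval-thin = record
    { _≤?_         = λ (x , _) (y , _) → x ≤? y
    ; rank         = λ (x , _) → len x
    ; rank-mono    = len-mono
    ; rank-antisym = len-antisym
    ; coatom       = λ {(x , v≤x , _)} {(y , _ , y≤w)} p n →
        let z , x≤z , z≤y , e = coatom p n
        in (z , ≤-trans v≤x x≤z , ≤-trans z≤y y≤w) , x≤z , z≤y , e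
    ; diamond      = λ {(x , v≤x , _)} {(z , _ , z≤w)} p e →
        let open Diamond (diamond p e)
            inside : ∀ {y} → Middle x z y → v ≤ y × y ≤ w
            inside m = ≤-trans v≤x (proj₁ m) , ≤-trans (proj₁ (proj₂ m)) z≤w
        in (x₁ , inside middle₁) , (x₂ , inside middle₂) , middle₁ , middle₂ , distinct , only
    }

theorem4p2 : ∀ {c ℓ a} (G : CoxeterGroup c ℓ a) (v w : CoxeterGroup.Carrier G) →
    Bruhat._≤_ G v w →
    IsBoolean (Bruhat.interval G v w) ⇔ IsModularLattice (Bruhat.interval G v w)
theorem4p2 G v w v≤w = mk⇔ (boolean⇒modular (Bruhat.interval G v w)) λ L →
  ThinModularLattice.isBoolean L (interval-thin G v w)
    {w , v≤w , ≤-refl} (λ (_ , _ , x≤w) → x≤w) {v , ≤-refl , v≤w} (λ (_ , v≤x , _) → v≤x)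
  where open BruhatOrder G using (≤-refl)
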